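{- Let $D=(N,A)$, $\mathcal{K}$, $\{D^k\}_{k\in\mathcal{K}}$ be an instance of SND-RR with time horizon $T$, $\mathcal{A}$ a valid arc partition, $G=G(D,\mathcal{A})=(V,E)$ the auxiliary flat network, and $G_S=(V_S,E_S\cup F_S)$ a partial network of $G$ satisfying properties (P1$'$) and (P2$'$) below. Then the optimal value of SND-RR$(G_S)$ is a lower bound on the optimal value of SND-RR$(G_T)$. (P1$'$) For all $k\in\mathcal{K}$, $(o'_k,r_k)\in V_S$ and $(d^0_k,l_k)\in V_S$; for all $v\in N$, $(v^0,T)\in V_S$ and $(u,0)\in V_S$ for all $u\in\mathcal{V}(v)$. (P2$'$) For all $xz\in E$ and all $(x,t)\in V_S$ with $t+\tau_{xz}\le T$, we have $((x,t),(z,t'))\in E_S$ where $t'=\max\{r: r\le t+\tau_{xz},\ (z,r)\in V_S\}$.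
   Context: An instance of SND-RR consists of: a directed graph $D=(N,A)$; for each $vw\in A$ a transit time $\tau_{vw}\in\mathbb{Z}_{>0}$, fixed cost $f_{vw}>0$, capacity $u_{vw}\in\mathbb{Z}_{>0}$, per-unit cost $c^k_{vw}>0$ for each commodity $k$; commodities $\mathcal{K}$, each with origin $o_k$, destination $d_k$, demand $q_k$, release time $r_k$, deadline $l_k$ (integers, earliest release $0$); subgraphs $D^k=(N^k,A^k)\subseteq D$ with $\delta^+_{D^k}(d_k)=\emptyset$ and $\delta^+_{D^k}(v)\ne\emptyset$ for $v\in N^k\setminus\{d_k\}$. $T=\max_kl_k$, $[T]=\{0,\dots,T\}$. For a timed arc $a=((v,t),(w,t'))$ with underlying arc $vw$: $u_a=u_{vw}$, $f_a=f_{vw}$, $c^k_a=c^k_{vw}$, $\tau_a=\tau_{vw}$ (not $t'-t$). $x^k(S)=\sum_{a\in S}x^k_a$; $\delta^\pm_H(v,t)$ are outgoing/incoming timed arcs in $H$. Valid partition: $\mathcal{A}=\{\mathcal{A}_v\}_{v\in N}$, each $\mathcal{A}_v$ a partition of $\delta^+_D(v)$, such that for each $k$, $\delta^+_{D^k}(v)\subseteq A_i$ for some $A_i\in\mathcal{A}_v$. Auxiliary network $G=(V,E)$: $\mathcal{V}(v)=\{v^0,\dots,v^{|\mathcal{A}_v|}\}$ (copy $v^i$ per part $A_i\in\mathcal{A}_v$, terminal copy $v^0$), $V=\bigcup_v\mathcal{V}(v)$, $E=\{v^iw^j:vw\in A_i\in\mathcal{A}_v,w^j\in\mathcal{V}(w)\}$,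 each $v^iw^j$ with the transit time and costs of $vw$. With $\mathcal{K}(A_i)=\{k:\emptyset\ne\delta^+_{D^k}(v)\subseteq A_i\}$: $G^k=(V^k,E^k)$, $V^k=\{v^i:v\in N^k,A_i\in\mathcal{A}_v,k\in\mathcal{K}(A_i)\}\cup\{d^0_k\}$, $E^k=\{v^iw^j:vw\in A^k,v^i,w^j\in V^k\}$; $o'_k$ is the unique copy of $o_k$ in $V^k$. Full time-expanded network of $G$: $G_T=(V_T,E_T\cup F_T)$ with $V_T=V\times[T]$, movement arcs $((x,t),(z,t+\tau_{xz}))$ for $xz\in E$, $t+\tau_{xz}\le T$, holdover arcs $((x,t),(x,t+1))$; similarly $G^k_T=(V^k_T,E^k_T\cup F^k_T)$, and $D_T=(N_T,A_T\cup H_T)$ for $D$. For $a=((v,t),(w,t'))\in A_T$, $\mathcal{E}_T(a)=\{((v^i,t),(w^j,t')):vw\in A_i\in\mathcal{A}_v,w^j\in\mathcal{V}(w)\}$. SND-RR$(G_T)$: minimize $\sum_{a\in A_T}f_ay_a+\sum_k\sum_{e\in E_T}c^k_eq_kx^k_e$ s.t. for all $k$, $(x,t)\in V^k_T$: $x^k(\delta^+_{G^k_T}(x,t))-x^k(\delta^-_{G^k_T}(x,t))$ is $1$ at $(o'_k,r_k)$, $-1$ at $(d^0_k,l_k)$, $0$ otherwise; $\sum_k\sum_{e\in\mathcal{E}_T(a)}q_kx^k_e\le u_ay_a$ for $a\in A_T$; $x^k_e\in\{0,1\}$ for $e\in E^k_T\cup F^k_T$ ($0$ otherwise); $y_a\in\mathbb{Z}_{\ge0}$.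 A partial network of $G$ is $G_S=(V_S,E_S\cup F_S)$ with $V_S\subseteq V_T$, $E_S\subseteq\{((x,t),(z,t')):(x,t)\in V_T,xz\in E,t'\le t+\tau_{xz}\le T\}$, and $F_S$ the holdover arcs joining each $(x,t)\in V_S$ to the next copy of $x$ in $V_S$. $G^k_S=(V^k_S,E^k_S\cup F^k_S)$: $V^k_S=\{(x,t)\in V_S:x\in V^k\}$, $E^k_S=\{((x,t),(z,t'))\in E_S:xz\in E^k\}$, $F^k_S$ the arcs of $F_S$ on copies of nodes of $V^k$. The associated partial network of $D$ is $D_S(G_S)=(N_S,A_S\cup H_S)$ with $N_S=\{(v,t):(u,t)\in V_S\text{ for some }u\in\mathcal{V}(v)\}$ and $A_S=\{((v,t),(w,t')):(v,t)\in N_S,vw\in A,t+\tau_{vw}\le T,t'=\max\{r:r\le t+\tau_{vw},(w,r)\in N_S\}\}$. For $a=((v,t),(w,t'))\in A_S$, $\mathcal{E}_S(a)=\{((v^i,t),(w^j,t''))\in E_S: w^j\in\mathcal{V}(w), vw\in A_i\in\mathcal{A}_v\}$. SND-RR$(G_S)$: minimize $\sum_{a\in A_S}f_ay_a+\sum_k\sum_{e\in E_S}c^k_eq_kx^k_e$ s.t. for all $k$, $(x,t)\in V^k_S$: $x^k(\delta^+_{G^k_S}(x,t))-x^k(\delta^-_{G^k_S}(x,t))$ is $1$ at $(o'_k,r_k)$, $-1$ at $(d^0_k,l_k)$, $0$ otherwise; $\sum_k\sum_{e\in\mathcal{E}_S(a)}q_kx^k_e\le u_ay_a$ for all $a\in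 A_S$; $\sum_{e\in E^k_S}\tau_ex^k_e\le l_k-r_k$ for all $k$; $x^k_e\in\{0,1\}$ for $e\in E^k_S\cup F^k_S$ ($0$ otherwise); $y_a\in\mathbb{Z}_{\ge0}$ for $a\in A_S$. -}

module Defs where

open import Level using (Level; suc; _⊔_; 0ℓ)
open import Algebra.Bundles using (AbelianGroup; CommutativeMonoid)
import Algebra.Definitions.RawMonoid as RawMonoid
import Algebra.Properties.CommutativeMonoid.Sum as FinSum
open import Data.Bool.Base using (if_then_else_)
open import Data.Empty using (⊥-elim)
open import Data.Fin.Base as Fin using (Fin; toℕ)
import Data.Fin.Properties as Fin
open import Data.Fin.Subset using (Subset; _∈_; _⊆_; Nonempty; Empty)
import Data.Fin.Subset as Subset
open import Data.Fin.Subset.Properties using (_∈?_; _⊆?_; nonempty?; ∉⊥)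
open import Data.Integer.Base as ℤ using (ℤ; _⊖_; 0ℤ; 1ℤ; -1ℤ)
open import Data.Nat.Base as ℕ using (ℕ; _+_; _*_; _≤_; _<_; s≤s; s≤s⁻¹)
import Data.Nat.Properties as ℕ
open import Data.Product.Base using (Σ; ∃; _×_; _,_; proj₁; proj₂)
open import Data.Product.Properties using (≡-dec)
open import Data.Sum.Base using (_⊎_; inj₁; inj₂)
import Data.Vec.Functional as Vector
open import Relation.Binary.Core using (Rel)
import Relation.Binary.Construct.NonStrictToStrict as ToStrict
import Relation.Binary.Construct.Add.Supremum.NonStrict as Supremum
open import Relation.Binary.Definitions using (DecidableEquality)
import Relation.Binary.Definitions as Binary
open import Relation.Binary.PropositionalEquality.Core using (_≡_; _≢_; refl; cong)
open import Relation.Binary.Structures using (IsTotalOrder)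
open import Relation.Nullary.Construct.Add.Supremum using (_⁺; [_]; ⊤⁺)
open import Relation.Nullary.Decidable using (Dec; yes; no; does; map′; _×-dec_; _⊎-dec_; _→-dec_)
open import Relation.Nullary.Negation.Core using (¬_)
open import Relation.Unary using (Pred; Decidable)

-- Costs are only ever added, compared, and multiplied by natural numbers, so
-- any totally ordered abelian group (ℝ, ℚ, ℤ, …) can serve as their domain.

record OrderedAbelianGroup (a ℓ₁ ℓ₂ : Level) : Set (suc (a ⊔ ℓ₁ ⊔ ℓ₂)) where
  field
    abelianGroup : AbelianGroup a ℓ₁
  open AbelianGroup abelianGroup public
  infix 4 _≼_
  field
    _≼_          : Rel Carrier ℓ₂
    isTotalOrder : IsTotalOrder _≈_ _≼_
    ∙-monoˡ      : ∀ {x y} z → x ≼ y → (x ∙ z) ≼ (y ∙ z)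

  open ToStrict _≈_ _≼_ public using () renaming (_<_ to _≺_)
  open Supremum _≼_ public using (_≤⁺_)
  open RawMonoid rawMonoid public using () renaming (_×_ to _·_)

-- The arc set A is given by the out-neighbourhoods: vw ∈ A iff w ∈ A v, so that
-- A v is δ⁺(v); likewise for each Dᵏ.  Arc data are functions of the pair of
-- endpoints and are constrained on arcs only.

record Instance {a ℓ₁ ℓ₂} (R : OrderedAbelianGroup a ℓ₁ ℓ₂) : Set (a ⊔ ℓ₁ ⊔ ℓ₂) where
  open OrderedAbelianGroup R using (Carrier; _≺_; ε)
  field
    n : ℕ
    A : Fin n → Subset n
    τ : Fin n → Fin n → ℕ
    f : Fin n → Fin n → Carrier
    u : Fin n → Fin n → ℕ
    κ : ℕ
    c : Fin κ → Fin n → Fin n → Carrier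
    o d   : Fin κ → Fin n
    q r l : Fin κ → ℕ
    Nᵏ : Fin κ → Subset n
    Aᵏ : Fin κ → Fin n → Subset n

    τ-pos : ∀ {v w} → w ∈ A v → 0 < τ v w
    f-pos : ∀ {v w} → w ∈ A v → ε ≺ f v w
    u-pos : ∀ {v w} → w ∈ A v → 0 < u v w
    c-pos : ∀ k {v w} → w ∈ A v → ε ≺ c k v w

    earliest-release : ∃ λ k → r k ≡ 0

    Aᵏ⊆A  : ∀ k v → Aᵏ k v ⊆ A v
    Aᵏ-tail : ∀ k {v w} → w ∈ Aᵏ k v → v ∈ Nᵏ k
    Aᵏ-head : ∀ k {v w} → w ∈ Aᵏ k v → w ∈ Nᵏ k
    o∈Nᵏ : ∀ k → o k ∈ Nᵏ k
    d∈Nᵏ : ∀ k → d k ∈ Nᵏ k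
    δ⁺d-empty    : ∀ k → Empty (Aᵏ k (d k))
    δ⁺v-nonempty : ∀ k {v} → v ∈ Nᵏ k → v ≢ d k → Nonempty (Aᵏ k v)

  Commodity : Set
  Commodity = Fin κ

  T : ℕ
  T = Vector.foldr ℕ._⊔_ 0 l

-- If δ⁺(v) = ∅ then 𝒜ᵥ is the empty partition; hence validity is only demanded
-- of those k and v for which δ⁺(v) in Dᵏ is nonempty.

record ValidPartition {a ℓ₁ ℓ₂} {R : OrderedAbelianGroup a ℓ₁ ℓ₂} (I : Instance R) : Set where
  open Instance I using (n; A; Aᵏ; Commodity)
  field
    size : Fin n → ℕ
    part : ∀ v → Fin (size v) → Subset n

    part-nonempty : ∀ v i → Nonempty (part v i)
    part-disjoint : ∀ v {i j w} → w ∈ part v i → w ∈ part v j → i ≡ j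
    part⊆A        : ∀ v i → part v i ⊆ A v
    part-covers   : ∀ {v w} → w ∈ A v → ∃ λ i → w ∈ part v i

    valid : ∀ (k : Commodity) v → Nonempty (Aᵏ k v) → ∃ λ i → Aᵏ k v ⊆ part v i

module Auxiliary {a ℓ₁ ℓ₂} {R : OrderedAbelianGroup a ℓ₁ ℓ₂}
                 {I : Instance R} (P : ValidPartition I) where
  open Instance I
  open ValidPartition P

  -- (v , zero) is the terminal copy v⁰; (v , suc i) is the copy of the i-th part.
  V : Set
  V = Σ (Fin n) λ v → Fin (ℕ.suc (size v))

  _≟V_ : DecidableEquality V
  _≟V_ = ≡-dec Fin._≟_ Fin._≟_

  -- The part of a copy, regarding terminal copies as having an empty part.
  partOf : V → Subset n
  partOf (v , Fin.zero)  = Subset.⊥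
  partOf (v , Fin.suc i) = part v i

  E : Rel V 0ℓ
  E x (w , j) = w ∈ partOf x

  -- k ∈ 𝒦(Aᵢ) for the part Aᵢ of a copy; never the case for a terminal copy.
  Uses : Commodity → Pred V 0ℓ
  Uses k x = Nonempty (Aᵏ k (proj₁ x)) × Aᵏ k (proj₁ x) ⊆ partOf x

  d⁰ : Commodity → V
  d⁰ k = d k , Fin.zero

  Vᵏ : Commodity → Pred V 0ℓ
  Vᵏ k x = (proj₁ x ∈ Nᵏ k × Uses k x) ⊎ x ≡ d⁰ k

  Eᵏ : Commodity → Rel V 0ℓ
  Eᵏ k x z = proj₁ z ∈ Aᵏ k (proj₁ x) × Vᵏ k x × Vᵏ k z

  Uses? : ∀ k → Decidable (Uses k)
  Uses? k x = nonempty? _ ×-dec (_ ⊆? _)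

  Vᵏ? : ∀ k → Decidable (Vᵏ k)
  Vᵏ? k x = ((_ ∈? _) ×-dec Uses? k x) ⊎-dec (x ≟V d⁰ k)

  Eᵏ? : ∀ k → Binary.Decidable (Eᵏ k)
  Eᵏ? k x z = (_ ∈? _) ×-dec (Vᵏ? k x ×-dec Vᵏ? k z)

  o′ : Commodity → V
  o′ k with o k Fin.≟ d k
  ... | yes _   = o k , Fin.zero
  ... | no o≢d  = o k , Fin.suc (proj₁ (valid k (o k) (δ⁺v-nonempty k (o∈Nᵏ k) o≢d)))

  o′-copy : ∀ k → proj₁ (o′ k) ≡ o k
  o′-copy k with o k Fin.≟ d k
  ... | yes _ = refl
  ... | no _  = refl

  o′∈Vᵏ : ∀ k → Vᵏ k (o′ k)
  o′∈Vᵏ k with o k Fin.≟ d k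
  ... | yes o≡d = inj₂ (cong (λ v → v , Fin.zero) o≡d)
  ... | no o≢d  = inj₁ (o∈Nᵏ k , ne , proj₂ (valid k (o k) ne))
    where ne = δ⁺v-nonempty k (o∈Nᵏ k) o≢d

  Vᵏ-unique-copy : ∀ k {x z} → Vᵏ k x → Vᵏ k z → proj₁ x ≡ proj₁ z → x ≡ z
  Vᵏ-unique-copy k (inj₂ refl) (inj₂ refl) _ = refl
  Vᵏ-unique-copy k (inj₂ refl) (inj₁ (_ , ne , _)) refl = ⊥-elim (δ⁺d-empty k ne)
  Vᵏ-unique-copy k (inj₁ (_ , ne , _)) (inj₂ refl) refl = ⊥-elim (δ⁺d-empty k ne)
  Vᵏ-unique-copy k {v , Fin.zero} (inj₁ (_ , (w , w∈) , ⊆p)) (inj₁ _) _ = ⊥-elim (∉⊥ (⊆p w∈))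
  Vᵏ-unique-copy k {v , Fin.suc i} {_ , Fin.zero} (inj₁ _) (inj₁ (_ , (w , w∈) , ⊆p)) _ = ⊥-elim (∉⊥ (⊆p w∈))
  Vᵏ-unique-copy k {v , Fin.suc i} {_ , Fin.suc j} (inj₁ (_ , (w , w∈) , ⊆i)) (inj₁ (_ , _ , ⊆j)) refl
    = cong (λ i → v , Fin.suc i) (part-disjoint v (⊆i w∈) (⊆j w∈))

  TNode : Set
  TNode = V × ℕ

  DNode : Set
  DNode = Fin n × ℕ

  -- r = max { s : s ≤ b, Q s }
  IsLatest : Pred ℕ 0ℓ → ℕ → ℕ → Set
  IsLatest Q b r = r ≤ b × Q r × (∀ {s} → s ≤ b → Q s → s ≤ r)

  isLatest? : ∀ {Q} → Decidable Q → ∀ b r → Dec (IsLatest Q b r)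
  isLatest? {Q} Q? b r = (r ℕ.≤? b) ×-dec (Q? r ×-dec
    map′ (λ (h : ∀ {s} → s < ℕ.suc b → Q s → s ≤ r) s≤b → h (s≤s s≤b))
         (λ (h : ∀ {s} → s ≤ b → Q s → s ≤ r) s<1+b → h (s≤s⁻¹ s<1+b))
         (ℕ.allUpTo? (λ s → Q? s →-dec (s ℕ.≤? r)) (ℕ.suc b)))

  -- A time expansion of G, together with the timed arcs of D on which capacity
  -- is installed and, for each of these, the timed arcs of G sharing that
  -- capacity.  Movement and holdover arcs are kept apart; the holdover arc
  -- ((x,t),(x,t')) is Hold x t t'.
  record TimedNetwork : Set₁ where
    field
      Node : Pred TNode 0ℓ
      Move : Rel TNode 0ℓ
      Hold : V → ℕ → ℕ → Set
      Arcᴰ : Rel DNode 0ℓ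
      ℰ    : DNode → DNode → Rel TNode 0ℓ

      Move? : Binary.Decidable Move
      Hold? : ∀ x t t′ → Dec (Hold x t t′)
      Arcᴰ? : Binary.Decidable Arcᴰ
      ℰ?    : ∀ a b → Binary.Decidable (ℰ a b)

  G_T : TimedNetwork
  G_T = record
    { Node = λ (x , t) → t ≤ T
    ; Move = λ (x , t) (z , t′) →
        E x z × t′ ≡ t + τ (proj₁ x) (proj₁ z) × t′ ≤ T
    ; Hold = λ x t t′ → t′ ≡ ℕ.suc t × t′ ≤ T
    ; Arcᴰ = λ (v , t) (w , t′) → w ∈ A v × t′ ≡ t + τ v w × t′ ≤ T
    ; ℰ    = λ (v , t) (w , t′) (x , s) (z , s′) →
        proj₁ x ≡ v × s ≡ t × proj₁ z ≡ w × s′ ≡ t′ × E x z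
    ; Move? = λ _ _ → (_ ∈? _) ×-dec ((_ ℕ.≟ _) ×-dec (_ ℕ.≤? _))
    ; Hold? = λ _ _ _ → (_ ℕ.≟ _) ×-dec (_ ℕ.≤? _)
    ; Arcᴰ? = λ _ _ → (_ ∈? _) ×-dec ((_ ℕ.≟ _) ×-dec (_ ℕ.≤? _))
    ; ℰ?    = λ _ _ _ _ → (_ Fin.≟ _) ×-dec ((_ ℕ.≟ _) ×-dec
        ((_ Fin.≟ _) ×-dec ((_ ℕ.≟ _) ×-dec (_ ∈? _))))
    }

  -- V_S and E_S are subsets of finite sets and hence decidable.
  record PartialNetwork : Set₁ where
    field
      V_S  : Pred TNode 0ℓ
      E_S  : Rel TNode 0ℓ
      V_S? : Decidable V_S
      E_S? : Binary.Decidable E_S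
      V_S⊆V_T : ∀ {x t} → V_S (x , t) → t ≤ T
      E_S-arc : ∀ {x t z t′} → E_S (x , t) (z , t′) →
                t ≤ T × E x z × t′ ≤ t + τ (proj₁ x) (proj₁ z) × t + τ (proj₁ x) (proj₁ z) ≤ T

    F_S : V → ℕ → ℕ → Set
    F_S x t t′ = V_S (x , t) × V_S (x , t′) × t < t′ × (∀ {s} → s < t′ → V_S (x , s) → s ≤ t)

    N_S : Pred DNode 0ℓ
    N_S (v , t) = ∃ λ i → V_S ((v , i) , t)

    A_S : Rel DNode 0ℓ
    A_S (v , t) (w , t′) =
      N_S (v , t) × w ∈ A v × t + τ v w ≤ T × IsLatest (λ r → N_S (w , r)) (t + τ v w) t′

    ℰ_S : DNode → DNode → Rel TNode 0ℓ
    ℰ_S (v , t) (w , t′) (x , s) (z , s′) =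
      E_S (x , s) (z , s′) × proj₁ x ≡ v × s ≡ t × proj₁ z ≡ w × w ∈ partOf x

    N_S? : Decidable N_S
    N_S? (v , t) = Fin.any? λ i → V_S? ((v , i) , t)

    timed : TimedNetwork
    timed = record
      { Node = V_S ; Move = E_S ; Hold = F_S ; Arcᴰ = A_S ; ℰ = ℰ_S
      ; Move? = E_S?
      ; Hold? = λ x t t′ → V_S? _ ×-dec (V_S? _ ×-dec ((t ℕ.<? t′) ×-dec
          ℕ.allUpTo? (λ s → V_S? (x , s) →-dec (s ℕ.≤? t)) t′))
      ; Arcᴰ? = λ _ (w , t′) → N_S? _ ×-dec ((_ ∈? _) ×-dec ((_ ℕ.≤? _) ×-dec
          isLatest? (λ r → N_S? (w , r)) _ t′))
      ; ℰ? = λ _ _ _ _ → E_S? _ _ ×-dec ((_ Fin.≟ _) ×-dec ((_ ℕ.≟ _) ×-dec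
          ((_ Fin.≟ _) ×-dec (_ ∈? _))))
      }

    record P1′ : Set where
      field
        origin      : ∀ k → V_S (o′ k , r k)
        destination : ∀ k → V_S (d⁰ k , l k)
        end         : ∀ v → V_S ((v , Fin.zero) , T)
        start       : ∀ x → V_S (x , 0)

    P2′ : Set
    P2′ = ∀ {x z t t′} → E x z → V_S (x , t) → t + τ (proj₁ x) (proj₁ z) ≤ T →
          IsLatest (λ r → V_S (z , r)) (t + τ (proj₁ x) (proj₁ z)) t′ →
          E_S (x , t) (z , t′)

  module Sums {a ℓ} (M : CommutativeMonoid a ℓ) where
    open CommutativeMonoid M using (Carrier; ε)
    open FinSum M public using (sum)

    infix 5 _when_
    _when_ : ∀ {p} {Q : Set p} → Carrier → Dec Q → Carrier
    s when Q? = if does Q? then s else ε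

    -- Sums over V × [T] and over N × [T]; all timed arcs have both ends there.
    ∑ⱽ : (TNode → Carrier) → Carrier
    ∑ⱽ g = sum λ (v : Fin n) → sum λ (i : Fin (ℕ.suc (size v))) →
           sum λ (t : Fin (ℕ.suc T)) → g ((v , i) , toℕ t)

    ∑ᴺ : (DNode → Carrier) → Carrier
    ∑ᴺ g = sum λ (v : Fin n) → sum λ (t : Fin (ℕ.suc T)) → g (v , toℕ t)

    ∑ᵗ : (ℕ → Carrier) → Carrier
    ∑ᵗ g = sum λ (t : Fin (ℕ.suc T)) → g (toℕ t)

  record Variables : Set where
    field
      move : Commodity → TNode → TNode → ℕ
      hold : Commodity → V → ℕ → ℕ → ℕ
      y    : DNode → DNode → ℕ

  module Program (H : TimedNetwork) where
    open TimedNetwork H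

    Nodeᵏ : Commodity → Pred TNode 0ℓ
    Nodeᵏ k (x , t) = Node (x , t) × Vᵏ k x

    Moveᵏ : Commodity → Rel TNode 0ℓ
    Moveᵏ k p p′ = Move p p′ × Eᵏ k (proj₁ p) (proj₁ p′)

    Holdᵏ : Commodity → V → ℕ → ℕ → Set
    Holdᵏ k x t t′ = Hold x t t′ × Vᵏ k x

    Moveᵏ? : ∀ k → Binary.Decidable (Moveᵏ k)
    Moveᵏ? k p p′ = Move? p p′ ×-dec Eᵏ? k _ _

    Holdᵏ? : ∀ k x t t′ → Dec (Holdᵏ k x t t′)
    Holdᵏ? k x t t′ = Hold? x t t′ ×-dec Vᵏ? k x

    module _ (X : Variables) where
      open Variables X
      open Sums ℕ.+-0-commutativeMonoid

      outflow inflow : Commodity → TNode → ℕ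
      outflow k (x , t) = ∑ⱽ (λ p → move k (x , t) p when Moveᵏ? k (x , t) p)
                        + ∑ᵗ (λ s → hold k x t s when Holdᵏ? k x t s)
      inflow  k (x , t) = ∑ⱽ (λ p → move k p (x , t) when Moveᵏ? k p (x , t))
                        + ∑ᵗ (λ s → hold k x s t when Holdᵏ? k x s t)

      netflow : Commodity → TNode → ℤ
      netflow k p = outflow k p ⊖ inflow k p

      load : DNode → DNode → ℕ
      load a b = sum λ (k : Commodity) → ∑ⱽ λ p → ∑ⱽ λ p′ →
                 q k * move k p p′ when ℰ? a b p p′

      duration : Commodity → ℕ
      duration k = ∑ⱽ λ p → ∑ⱽ λ p′ →
        τ (proj₁ (proj₁ p)) (proj₁ (proj₁ p′)) * move k p p′ when Moveᵏ? k p p′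

      record Feasible : Set where
        field
          balance-origin : ∀ k p → Nodeᵏ k p → p ≡ (o′ k , r k) → netflow k p ≡ 1ℤ
          balance-destination : ∀ k p → Nodeᵏ k p → p ≡ (d⁰ k , l k) → netflow k p ≡ -1ℤ
          balance-otherwise : ∀ k p → Nodeᵏ k p → p ≢ (o′ k , r k) → p ≢ (d⁰ k , l k) →
                              netflow k p ≡ 0ℤ

          capacity : ∀ a b → Arcᴰ a b → load a b ≤ u (proj₁ a) (proj₁ b) * y a b

          move-binary  : ∀ k p p′ → move k p p′ ≡ 0 ⊎ move k p p′ ≡ 1
          hold-binary  : ∀ k x t t′ → hold k x t t′ ≡ 0 ⊎ hold k x t t′ ≡ 1
          move-support : ∀ k p p′ → ¬ Moveᵏ k p p′ → move k p p′ ≡ 0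
          hold-support : ∀ k x t t′ → ¬ Holdᵏ k x t t′ → hold k x t t′ ≡ 0

    module _ (X : Variables) where
      open Variables X
      open OrderedAbelianGroup R using (Carrier; _∙_; _·_; commutativeMonoid)
      open Sums commutativeMonoid

      objective : Carrier
      objective =
        (∑ᴺ λ a → ∑ᴺ λ b → y a b · f (proj₁ a) (proj₁ b) when Arcᴰ? a b)
        ∙ (sum λ (k : Commodity) → ∑ⱽ λ p → ∑ⱽ λ p′ →
            (q k * move k p p′) · c k (proj₁ (proj₁ p)) (proj₁ (proj₁ p′)) when Move? p p′)

-- The optimal value of a minimisation problem is +∞ (⊤⁺) when it is infeasible.

record MinProblem {a ℓ₁ ℓ₂} (R : OrderedAbelianGroup a ℓ₁ ℓ₂) : Set (suc 0ℓ ⊔ a) where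
  open OrderedAbelianGroup R using (Carrier)
  field
    Solution : Set
    Feasible : Pred Solution 0ℓ
    value    : Solution → Carrier

module _ {a ℓ₁ ℓ₂} {R : OrderedAbelianGroup a ℓ₁ ℓ₂} where
  open OrderedAbelianGroup R using (Carrier; _≈_; _≼_)

  IsOptimalValue : MinProblem R → Carrier ⁺ → Set (ℓ₁ ⊔ ℓ₂)
  IsOptimalValue Π [ z ] =
    (∃ λ s → Feasible s × value s ≈ z) × (∀ s → Feasible s → z ≼ value s)
    where open MinProblem Π
  IsOptimalValue Π ⊤⁺    = Level.Lift (ℓ₁ ⊔ ℓ₂) (∀ s → ¬ Feasible s)
    where open MinProblem Π

module _ {a ℓ₁ ℓ₂} {R : OrderedAbelianGroup a ℓ₁ ℓ₂} {I : Instance R} (P : ValidPartition I) where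
  open Instance I using (r; l)
  open Auxiliary P

  SND-RR-full : MinProblem R
  SND-RR-full = record { Solution = Variables ; Feasible = Feasible ; value = objective }
    where open Program G_T

  SND-RR-partial : PartialNetwork → MinProblem R
  SND-RR-partial G = record
    { Solution = Variables
    ; Feasible = λ X → Feasible X × (∀ k → ℤ.+ duration X k ℤ.≤ l k ⊖ r k)
    ; value    = objective
    }
    where open Program (PartialNetwork.timed G)

{-# OPTIONS --safe #-}
module Submission where

-- A solution of SND-RR(G_T) is pushed down to G_S.  Each node (x , t) is rounded
-- to the latest copy of x in V_S not after t, and a movement arc leaving (x , t)
-- is replaced by the arc that (P2′) provides at the rounded node; this can only
-- arrive earlier, and waiting along holdover arcs makes up for it.  Following the
-- flow of commodity k in G_T thus yields a walk in G_S from its origin to its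
-- destination, whose total transit time is at most l k − r k.  Cutting out its
-- cycles makes it a 0/1-flow, and each of its movement arcs is still the image of
-- an arc used in G_T, so flow costs and loads do not increase.  For the capacity
-- note that an arc vw belongs to the part of just one copy of v.  Hence all arcs
-- of G_T sharing a timed arc of D are rounded in the same way, and the installed
-- capacity can be moved along with the flow at no extra fixed cost.

open import Defs
open import Relation.Nullary.Construct.Add.Supremum using (_⁺; [_]; ⊤⁺)
open import Level using (Level; _⊔_; 0ℓ; lift)
open import Algebra.Bundles using (CommutativeMonoid)
import Algebra.Properties.CommutativeMonoid.Sum as FinSum
import Algebra.Properties.CommutativeSemigroup as CommutativeSemigroup
import Algebra.Properties.Monoid.Mult as Mult
open import Data.Bool.Base using (if_then_else_)
open import Data.Empty using (⊥; ⊥-elim)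
open import Data.Fin.Base as Fin using (Fin; zero; suc; toℕ; fromℕ<)
open import Data.Fin.Properties as Fin using (suc-injective; toℕ-injective; toℕ-fromℕ<; toℕ≤pred[n])
open import Data.Fin.Subset using (_∈_)
open import Data.Fin.Subset.Properties using (_∈?_; ∉⊥)
open import Data.Integer.Base as ℤ using (_⊖_; 0ℤ; 1ℤ; -1ℤ)
import Data.Integer.Properties as ℤ
open import Data.Nat.Base as ℕ using (ℕ; _+_; _*_; _≤_; _<_; s≤s; z≤n)
import Data.Nat.Properties as ℕ
open import Data.Product.Base using (Σ; ∃; _×_; _,_; proj₁; proj₂)
open import Data.Product.Properties using (≡-dec)
open import Data.Sum.Base using (_⊎_; inj₁; inj₂; [_,_]′)
open import Data.Unit.Base using (⊤; tt)
open import Function.Base using (_∘_; const)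
open import Relation.Binary.Construct.Add.Supremum.NonStrict using ([_]; _≤⊤⁺)
open import Relation.Binary.Construct.Closure.ReflexiveTransitive using (Star; _◅_)
  renaming (ε to stop)
open import Relation.Binary.Core using (Rel)
open import Relation.Binary.Definitions using (DecidableEquality)
open import Relation.Binary.PropositionalEquality as ≡ using (_≡_; _≢_; refl)
open import Relation.Binary.Structures using (IsPreorder; IsTotalOrder)
open import Relation.Nullary.Decidable using (Dec; yes; no; does)
open import Relation.Nullary.Negation.Core using (¬_; contradiction)
open import Relation.Unary using (Pred; Decidable)

-- Summation in ordered commutative monoids

record PreorderedMonoid (c ℓ₁ ℓ₂ : Level) : Set (Level.suc (c ⊔ ℓ₁ ⊔ ℓ₂)) where
  infix 4 _≼_
  field
    commutativeMonoid : CommutativeMonoid c ℓ₁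
  open CommutativeMonoid commutativeMonoid public
  field
    _≼_        : Rel Carrier ℓ₂
    isPreorder : IsPreorder _≈_ _≼_
    ∙-mono     : ∀ {x y u v} → x ≼ y → u ≼ v → (x ∙ u) ≼ (y ∙ v)
  open IsPreorder isPreorder public using () renaming (reflexive to ≼-reflexive; trans to ≼-trans)

+-≤-monoid : PreorderedMonoid 0ℓ 0ℓ 0ℓ
+-≤-monoid = record
  { commutativeMonoid = ℕ.+-0-commutativeMonoid ; isPreorder = ℕ.≤-isPreorder ; ∙-mono = ℕ.+-mono-≤ }

module OrderedSums {c ℓ₁ ℓ₂} (M : PreorderedMonoid c ℓ₁ ℓ₂) where
  open PreorderedMonoid M
    renaming (refl to ≈-refl; sym to ≈-sym; trans to ≈-trans; ≼-reflexive to reflexive; reflexive to ≡⇒≈)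
  open FinSum commutativeMonoid using (sum)
  open CommutativeSemigroup commutativeSemigroup using (interchange)

  infix 5 _when_
  _when_ : ∀ {p} {Q : Set p} → Carrier → Dec Q → Carrier
  s when Q? = if does Q? then s else ε

  -- What a functional must satisfy for a sum to be pulled through it. Other sums are instances, and
  -- so is scaling by a constant, with `J = ⊤`.
  record Additive {J : Set} (F : (J → Carrier) → Carrier) : Set (c ⊔ ℓ₁) where
    field
      F-cong : ∀ {g h} → (∀ j → g j ≈ h j) → F g ≈ F h
      F-homo : ∀ g h → F (λ j → g j ∙ h j) ≈ F g ∙ F h
      F-zero : F (const ε) ≈ ε

  -- An interface that hides how the indices are enumerated: `In` marks the indices actually summed
  -- over, so that `ℕ` can index a sum up to a bound. `search` is exhaustive search over these
  -- finitely many indices.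
  record IsSummation {I : Set} (In : Pred I 0ℓ) (∑ : (I → Carrier) → Carrier) :
                     Set (Level.suc 0ℓ ⊔ c ⊔ ℓ₁ ⊔ ℓ₂) where
    field
      ∑-cong : ∀ {g h} → (∀ i → In i → g i ≈ h i) → ∑ g ≈ ∑ h
      ∑-mono : ∀ {g h} → (∀ i → In i → g i ≼ h i) → ∑ g ≼ ∑ h
      ∑-homo : ∀ g h → ∑ (λ i → g i ∙ h i) ≈ ∑ g ∙ ∑ h
      ∑-zero : ∑ (const ε) ≈ ε
      single : ∀ {g} j → In j → (∀ i → i ≢ j → g i ≈ ε) → ∑ g ≈ g j
      ∑-swap : ∀ {J F} → Additive {J} F → ∀ (g : I → J → Carrier) →
               ∑ (λ i → F (g i)) ≈ F (λ j → ∑ (λ i → g i j))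
      search : ∀ {P Q : Pred I 0ℓ} → (∀ i → P i ⊎ Q i) → ∃ P ⊎ (∀ i → In i → Q i)

    additive : Additive ∑
    additive = record { F-cong = λ eq → ∑-cong λ i _ → eq i ; F-homo = ∑-homo ; F-zero = ∑-zero }

    ∑-map : ∀ {h : Carrier → Carrier} → Additive {⊤} (λ k → h (k tt)) →
            ∀ g → ∑ (h ∘ g) ≈ h (∑ g)
    ∑-map h-additive g = ∑-swap h-additive (λ i _ → g i)

    ∑-when : ∀ {p} {Q : Set p} (Q? : Dec Q) g → ∑ (λ i → g i when Q?) ≈ (∑ g when Q?)
    ∑-when (yes _) g = ≈-refl
    ∑-when (no _)  g = ∑-zero

  fin-sum : ∀ n → IsSummation (const ⊤) (sum {n})
  fin-sum n = record
    { ∑-cong = λ {g} {h} → cong′ n {g} {h} ; ∑-mono = λ {g} {h} → mono′ n {g} {h}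
    ; ∑-homo = homo′ n ; ∑-zero = zero′ n
    ; single = λ {g} j _ → single′ j g ; ∑-swap = λ {J} {F} → swap′ n {J} {F}
    ; search = λ {P} {Q} → search′ n {P} {Q} }
    where
    cong′ : ∀ m {g h : Fin m → Carrier} → (∀ i → ⊤ → g i ≈ h i) → sum g ≈ sum h
    cong′ ℕ.zero    eq = ≈-refl
    cong′ (ℕ.suc m) eq = ∙-cong (eq zero tt) (cong′ m (eq ∘ suc))

    mono′ : ∀ m {g h : Fin m → Carrier} → (∀ i → ⊤ → g i ≼ h i) → sum g ≼ sum h
    mono′ ℕ.zero    le = reflexive ≈-refl
    mono′ (ℕ.suc m) le = ∙-mono (le zero tt) (mono′ m (le ∘ suc))

    homo′ : ∀ m (g h : Fin m → Carrier) → sum (λ i → g i ∙ h i) ≈ sum g ∙ sum h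
    homo′ ℕ.zero    g h = ≈-sym (identityˡ ε)
    homo′ (ℕ.suc m) g h = ≈-trans (∙-congˡ (homo′ m (g ∘ suc) (h ∘ suc))) (interchange _ _ _ _)

    zero′ : ∀ m → sum {m} (const ε) ≈ ε
    zero′ ℕ.zero    = ≈-refl
    zero′ (ℕ.suc m) = ≈-trans (identityˡ _) (zero′ m)

    single′ : ∀ {m} (j : Fin m) (g : Fin m → Carrier) → (∀ i → i ≢ j → g i ≈ ε) → sum g ≈ g j
    single′ {ℕ.suc m} zero g vanish =
      ≈-trans (∙-congˡ (≈-trans (cong′ m λ i _ → vanish (suc i) λ ()) (zero′ m))) (identityʳ _)
    single′ (suc j) g vanish = ≈-trans
      (∙-cong (vanish zero λ ()) (single′ j (g ∘ suc) λ i i≢j → vanish (suc i) (i≢j ∘ suc-injective)))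
      (identityˡ _)

    swap′ : ∀ m {J F} → Additive {J} F → ∀ (g : Fin m → J → Carrier) →
            sum (λ i → F (g i)) ≈ F (λ j → sum (λ i → g i j))
    swap′ ℕ.zero    F-add g = ≈-sym (Additive.F-zero F-add)
    swap′ (ℕ.suc m) F-add g =
      ≈-trans (∙-congˡ (swap′ m F-add (g ∘ suc))) (≈-sym (Additive.F-homo F-add _ _))

    search′ : ∀ m {P Q : Pred (Fin m) 0ℓ} → (∀ i → P i ⊎ Q i) → ∃ P ⊎ (∀ i → ⊤ → Q i)
    search′ ℕ.zero    P⊎Q = inj₂ λ ()
    search′ (ℕ.suc m) P⊎Q with P⊎Q zero | search′ m (P⊎Q ∘ suc)
    ... | inj₁ p  | _            = inj₁ (zero , p)
    ... | inj₂ _  | inj₁ (i , p) = inj₁ (suc i , p)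
    ... | inj₂ q₀ | inj₂ q       = inj₂ λ { zero _ → q₀ ; (suc i) _ → q i tt }

  range-sum : ∀ m → IsSummation (ℕ._≤ m) (λ g → sum {ℕ.suc m} (g ∘ toℕ))
  range-sum m = record
    { ∑-cong = λ eq → ∑-cong λ i _ → eq (toℕ i) (toℕ≤pred[n] i)
    ; ∑-mono = λ le → ∑-mono λ i _ → le (toℕ i) (toℕ≤pred[n] i)
    ; ∑-homo = λ g h → ∑-homo (g ∘ toℕ) (h ∘ toℕ)
    ; ∑-zero = ∑-zero
    ; single = λ {g} j j≤m vanish → ≡.subst (λ j → _ ≈ g j) (toℕ-fromℕ< (s≤s j≤m))
        (single (fromℕ< (s≤s j≤m)) tt λ i i≢j → vanish (toℕ i) λ eq →
          i≢j (toℕ-injective (≡.trans eq (≡.sym (toℕ-fromℕ< (s≤s j≤m))))))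
    ; ∑-swap = λ F-add g → ∑-swap F-add (g ∘ toℕ)
    ; search = λ {P} {Q} P⊎Q → case P Q (search (P⊎Q ∘ toℕ)) }
    where
    open IsSummation (fin-sum (ℕ.suc m))
    case : ∀ (P Q : Pred ℕ 0ℓ) → ∃ (P ∘ toℕ) ⊎ (∀ i → ⊤ → Q (toℕ i)) → ∃ P ⊎ (∀ j → j ℕ.≤ m → Q j)
    case P Q (inj₁ (i , p)) = inj₁ (toℕ i , p)
    case P Q (inj₂ q) = inj₂ λ j j≤m → ≡.subst Q (toℕ-fromℕ< (s≤s j≤m)) (q (fromℕ< (s≤s j≤m)) tt)

  module _ {I : Set} {J : I → Set} {In : Pred I 0ℓ} {In′ : ∀ i → Pred (J i) 0ℓ}
           {∑ : (I → Carrier) → Carrier} {∑′ : ∀ i → (J i → Carrier) → Carrier} where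

    nested-sum : IsSummation In ∑ → (∀ i → IsSummation (In′ i) (∑′ i)) →
                 IsSummation {Σ I J} (λ (i , j) → In i × In′ i j)
                                     (λ g → ∑ λ i → ∑′ i λ j → g (i , j))
    nested-sum S S′ = record
      { ∑-cong = λ eq → S.∑-cong λ i i∈ → S′.∑-cong i λ j j∈ → eq (i , j) (i∈ , j∈)
      ; ∑-mono = λ le → S.∑-mono λ i i∈ → S′.∑-mono i λ j j∈ → le (i , j) (i∈ , j∈)
      ; ∑-homo = λ g h → ≈-trans (S.∑-cong λ i _ → S′.∑-homo i _ _) (S.∑-homo _ _)
      ; ∑-zero = ≈-trans (S.∑-cong λ i _ → S′.∑-zero i) S.∑-zero
      ; single = λ { {g} (i , j) (i∈ , j∈) vanish → ≈-trans
          (S.single i i∈ λ i′ i′≢i → ≈-trans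
            (S′.∑-cong i′ λ j′ _ → vanish (i′ , j′) λ { refl → i′≢i refl })
            (S′.∑-zero i′))
          (S′.single i j j∈ λ j′ j′≢j → vanish (i , j′) λ { refl → j′≢j refl }) }
      ; ∑-swap = λ F-add g → ≈-trans
          (S.∑-cong λ i _ → S′.∑-swap i F-add (λ j → g (i , j)))
          (S.∑-swap F-add _)
      ; search = λ {P} {Q} P⊎Q → case P Q (S.search λ i → S′.search i λ j → P⊎Q (i , j)) }
      where
      module S = IsSummation S
      module S′ i = IsSummation (S′ i)
      case : ∀ (P Q : Pred (Σ I J) 0ℓ) →
             (∃ λ i → ∃ λ j → P (i , j)) ⊎ (∀ i → In i → ∀ j → In′ i j → Q (i , j)) →
             ∃ P ⊎ (∀ ij → In (proj₁ ij) × In′ (proj₁ ij) (proj₂ ij) → Q ij)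
      case P Q (inj₁ (i , j , p)) = inj₁ ((i , j) , p)
      case P Q (inj₂ q) = inj₂ λ (i , j) (i∈ , j∈) → q i i∈ j j∈

  -- Conditional terms and sums over fibres

  when-true : ∀ {p} {Q : Set p} {s} (Q? : Dec Q) → Q → (s when Q?) ≡ s
  when-true (yes _) _ = refl
  when-true (no ¬q) q = ⊥-elim (¬q q)

  when-false : ∀ {p} {Q : Set p} {s} (Q? : Dec Q) → (Q → s ≈ ε) → (s when Q?) ≈ ε
  when-false (yes q) s≈ε = s≈ε q
  when-false (no _)  _   = ≈-refl

  when-nonneg : ∀ {p} {Q : Set p} {s} (Q? : Dec Q) → (Q → ε ≼ s) → ε ≼ (s when Q?)
  when-nonneg (yes q) 0≤s = 0≤s q
  when-nonneg (no _)  _   = reflexive ≈-refl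

  when-≤ : ∀ {p} {Q : Set p} {s} (Q? : Dec Q) → ε ≼ s → (s when Q?) ≼ s
  when-≤ (yes _) _   = reflexive ≈-refl
  when-≤ (no _)  0≤s = 0≤s

  module _ {I : Set} {In : Pred I 0ℓ} {∑ : (I → Carrier) → Carrier}
           (S : IsSummation In ∑) (_≟_ : DecidableEquality I) where
    open IsSummation S

    ∑-δ : ∀ {s} j → In j → ∑ (λ i → s when j ≟ i) ≈ s
    ∑-δ {s} j j∈ = ≈-trans
      (single j j∈ λ i i≢j → when-false (j ≟ i) λ j≡i → ⊥-elim (i≢j (≡.sym j≡i)))
      (≡⇒≈ (when-true (j ≟ j) refl))

    -- Compare `g` termwise with the family that is `g j` at `j` and `ε` elsewhere.
    term≤∑ : ∀ {g} → (∀ i → ε ≼ g i) → ∀ i → In i → g i ≼ ∑ g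
    term≤∑ {g} 0≤g j j∈ = ≼-trans (reflexive (≈-sym (∑-δ j j∈))) (∑-mono below)
      where
      below : ∀ i → In i → (g j when j ≟ i) ≼ g i
      below i _ with j ≟ i
      ... | yes refl = reflexive ≈-refl
      ... | no _     = 0≤g i

  module _ {I I′ : Set} {In : Pred I 0ℓ} {In′ : Pred I′ 0ℓ}
           {∑ : (I → Carrier) → Carrier} {∑′ : (I′ → Carrier) → Carrier}
           (S : IsSummation In ∑) (S′ : IsSummation In′ ∑′)
           (_≟_ : DecidableEquality I) (_≟′_ : DecidableEquality I′) (φ : I → I′) where
    private
      module S  = IsSummation S
      module S′ = IsSummation S′

    -- After interchanging the sums, each `i` contributes to the single index `φ i`. If that index
    -- lies outside the range of `∑′`, the contribution must vanish, hence `range`.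
    ∑-fibres : ∀ {g} → (∀ i → In i → In′ (φ i) ⊎ g i ≈ ε) →
               ∑′ (λ i′ → ∑ λ i → g i when φ i ≟′ i′) ≈ ∑ g
    ∑-fibres {g} range = ≈-trans
      (≈-sym (S.∑-swap S′.additive (λ i i′ → g i when φ i ≟′ i′)))
      (S.∑-cong fibre)
      where
      fibre : ∀ i → In i → ∑′ (λ i′ → g i when φ i ≟′ i′) ≈ g i
      fibre i i∈ with range i i∈
      ... | inj₁ φi∈ = ∑-δ S′ _≟′_ (φ i) φi∈
      ... | inj₂ g≈ε = ≈-trans
        (≈-trans (S′.∑-cong λ i′ _ → when-false (φ i ≟′ i′) λ _ → g≈ε) S′.∑-zero) (≈-sym g≈ε)

    -- Each relevant `g′ i′` is charged to one member of its fibre. As `g` is nonnegative, the whole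
    -- fibre sum dominates that member, and the fibre sums add up to `∑ g`; it does no harm that `φ`
    -- merges indices.
    ∑-pushforward : ∀ {g g′} → (∀ i → ε ≼ g i) → (∀ i → In i → In′ (φ i) ⊎ g i ≈ ε) →
                    (∀ i′ → g′ i′ ≼ ε ⊎ ∃ λ i → In i × φ i ≡ i′ × g′ i′ ≼ g i) →
                    ∑′ g′ ≼ ∑ g
    ∑-pushforward {g} {g′} 0≤g range dominated =
      ≼-trans (S′.∑-mono below) (reflexive (∑-fibres range))
      where
      0≤ : ∀ i′ i → ε ≼ (g i when φ i ≟′ i′)
      0≤ i′ i = when-nonneg (φ i ≟′ i′) λ _ → 0≤g i
      below : ∀ i′ → In′ i′ → g′ i′ ≼ ∑ (λ i → g i when φ i ≟′ i′)
      below i′ _ with dominated i′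
      ... | inj₁ g′≤ε = ≼-trans g′≤ε
        (≼-trans (reflexive (≈-sym S.∑-zero)) (S.∑-mono λ i _ → 0≤ i′ i))
      ... | inj₂ (i , i∈ , refl , g′≤g) = ≼-trans g′≤g
        (≼-trans (reflexive (≡⇒≈ (≡.sym (when-true (φ i ≟′ φ i) refl))))
                 (term≤∑ S _≟_ (0≤ (φ i)) i i∈))

module ℕSums = OrderedSums +-≤-monoid

-- Walks in time-expanded networks

module Walks {X : Set} (_≟X_ : DecidableEquality X) {T : ℕ}
  {∑ᵖ : (X × ℕ → ℕ) → ℕ} {∑ᵗ : (ℕ → ℕ) → ℕ}
  (∑ᵖ-sum : ℕSums.IsSummation (λ (_ , t) → t ≤ T) ∑ᵖ)
  (∑ᵗ-sum : ℕSums.IsSummation (_≤ T) ∑ᵗ)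
  (Arc : Rel (X × ℕ) 0ℓ) (Wait : X → ℕ → ℕ → Set)
  (arc-range : ∀ {x t z s} → Arc (x , t) (z , s) → t ≤ T × s ≤ T)
  (wait-range : ∀ {x t s} → Wait x t s → t ≤ T × s ≤ T)
  (weight : X × ℕ → X × ℕ → ℕ) where

  open ℕSums
  open CommutativeSemigroup ℕ.+-commutativeSemigroup using (x∙yz≈y∙xz; x∙yz≈zy∙x)

  -- Abstract, so that case distinctions are not blocked by the unfolding of ℕ._≟_.
  abstract
    _≟ᵗ_ : DecidableEquality ℕ
    _≟ᵗ_ = ℕ._≟_

    _≟ᵖ_ : DecidableEquality (X × ℕ)
    _≟ᵖ_ = ≡-dec _≟X_ ℕ._≟_

  δ : X × ℕ → X × ℕ → ℕ
  δ p a = 1 when p ≟ᵖ a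

  -- Holdover variables are indexed by node and times separately, whereas flow balance is stated at
  -- timed nodes; this reconciles the two.
  δ-componentwise : ∀ x t y s → δ (x , t) (y , s) ≡ ((1 when (t ≟ᵗ s)) when x ≟X y)
  δ-componentwise x t y s = case ((x , t) ≟ᵖ (y , s)) (x ≟X y) (t ≟ᵗ s)
    where
    case : (d : Dec ((x , t) ≡ (y , s))) (d₁ : Dec (x ≡ y)) (d₂ : Dec (t ≡ s)) →
           (1 when d) ≡ ((1 when d₂) when d₁)
    case d (yes refl) (yes refl) = when-true d refl
    case d (yes refl) (no t≢s)   = when-false d λ { refl → ⊥-elim (t≢s refl) }
    case d (no x≢y)   _          = when-false d λ { refl → ⊥-elim (x≢y refl) }

  data Step : Rel (X × ℕ) 0ℓ where
    moving  : ∀ {p p′} → Arc p p′ → Step p p′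
    waiting : ∀ {x t t′} → Wait x t t′ → Step (x , t) (x , t′)

  Walk : Rel (X × ℕ) 0ℓ
  Walk = Star Step

  -- Testing tail and head one after the other lets a sum over either end collapse by `∑-when` and
  -- `∑-δ`.
  move-unit : X × ℕ → X × ℕ → X × ℕ → X × ℕ → ℕ
  move-unit p p′ a b = δ p′ b when p ≟ᵖ a

  hold-unit : X → ℕ → ℕ → X → ℕ → ℕ → ℕ
  hold-unit x t t′ y s s′ = ((1 when (t′ ≟ᵗ s′)) when (t ≟ᵗ s)) when x ≟X y

  moves : ∀ {p q} → Walk p q → X × ℕ → X × ℕ → ℕ
  moves stop                         a b = 0
  moves (moving {p} {p′} _ ◅ W)      a b = move-unit p p′ a b + moves W a b
  moves (waiting _ ◅ W)              a b = moves W a b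

  holds : ∀ {p q} → Walk p q → X → ℕ → ℕ → ℕ
  holds stop                         y s s′ = 0
  holds (moving _ ◅ W)               y s s′ = holds W y s s′
  holds (waiting {x} {t} {t′} _ ◅ W) y s s′ = hold-unit x t t′ y s s′ + holds W y s s′

  length : ∀ {p q} → Walk p q → ℕ
  length stop                    = 0
  length (moving {p} {p′} _ ◅ W) = weight p p′ + length W
  length (waiting _ ◅ W)         = length W

  leaving entering : ∀ {p q} → Walk p q → X × ℕ → ℕ
  leaving  W (y , s) = ∑ᵖ (λ b → moves W (y , s) b) + ∑ᵗ (λ s′ → holds W y s s′)
  entering W (y , s) = ∑ᵖ (λ b → moves W b (y , s)) + ∑ᵗ (λ s′ → holds W y s′ s)

  private
    module ᵖ = IsSummation ∑ᵖ-sum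
    module ᵗ = IsSummation ∑ᵗ-sum
    module ᵖ² = IsSummation (nested-sum ∑ᵖ-sum λ _ → ∑ᵖ-sum)

  open ≡.≡-Reasoning

  shiftˡ : ∀ {m n} k o → m ≡ k + n → m + o ≡ k + (n + o)
  shiftˡ {n = n} k o eq = ≡.trans (≡.cong (_+ o) eq) (ℕ.+-assoc k n o)

  shiftʳ : ∀ {m n} k o → m ≡ k + n → o + m ≡ k + (o + n)
  shiftʳ {n = n} k o eq = ≡.trans (≡.cong (o +_) eq) (x∙yz≈y∙xz o k n)

  leaving-◅ : ∀ {p p′ q} (st : Step p p′) (W : Walk p′ q) a →
              leaving (st ◅ W) a ≡ δ p a + leaving W a
  leaving-◅ (moving {p} {p′} arc) W a@(y , s) = shiftˡ (δ p a) (∑ᵗ λ s′ → holds W y s s′) (begin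
    ∑ᵖ (λ b → move-unit p p′ a b + moves W a b)
      ≡⟨ ᵖ.∑-homo (λ b → move-unit p p′ a b) (λ b → moves W a b) ⟩
    ∑ᵖ (λ b → move-unit p p′ a b) + ∑ᵖ (λ b → moves W a b)
      ≡⟨ ≡.cong (_+ ∑ᵖ (λ b → moves W a b)) (ᵖ.∑-when (p ≟ᵖ a) (δ p′)) ⟩
    (∑ᵖ (δ p′) when p ≟ᵖ a) + ∑ᵖ (λ b → moves W a b)
      ≡⟨ ≡.cong (λ m → (m when p ≟ᵖ a) + ∑ᵖ (λ b → moves W a b))
           (∑-δ ∑ᵖ-sum _≟ᵖ_ {1} p′ (proj₂ (arc-range arc))) ⟩
    δ p a + ∑ᵖ (λ b → moves W a b) ∎)
  leaving-◅ (waiting {x} {t} {t′} wait) W a@(y , s) = shiftʳ (δ (x , t) a) (∑ᵖ λ b → moves W a b) (begin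
    ∑ᵗ (λ s′ → hold-unit x t t′ y s s′ + holds W y s s′)
      ≡⟨ ᵗ.∑-homo (hold-unit x t t′ y s) (holds W y s) ⟩
    ∑ᵗ (hold-unit x t t′ y s) + ∑ᵗ (holds W y s)
      ≡⟨ ≡.cong (_+ ∑ᵗ (holds W y s)) (≡.trans
           (ᵗ.∑-when (x ≟X y) (λ s′ → (1 when (t′ ≟ᵗ s′)) when (t ≟ᵗ s)))
           (≡.cong (_when (x ≟X y)) (ᵗ.∑-when (t ≟ᵗ s) (λ s′ → 1 when (t′ ≟ᵗ s′))))) ⟩
    ((∑ᵗ (λ s′ → 1 when (t′ ≟ᵗ s′)) when (t ≟ᵗ s)) when (x ≟X y)) + ∑ᵗ (holds W y s)
      ≡⟨ ≡.cong (λ m → ((m when (t ≟ᵗ s)) when (x ≟X y)) + ∑ᵗ (holds W y s))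
           (∑-δ ∑ᵗ-sum _≟ᵗ_ {1} t′ (proj₂ (wait-range wait))) ⟩
    ((1 when (t ≟ᵗ s)) when (x ≟X y)) + ∑ᵗ (holds W y s)
      ≡⟨ ≡.cong (_+ ∑ᵗ (holds W y s)) (δ-componentwise x t y s) ⟨
    δ (x , t) a + ∑ᵗ (holds W y s) ∎)

  entering-◅ : ∀ {p p′ q} (st : Step p p′) (W : Walk p′ q) a →
               entering (st ◅ W) a ≡ δ p′ a + entering W a
  entering-◅ (moving {p} {p′} arc) W a@(y , s) = shiftˡ (δ p′ a) (∑ᵗ λ s′ → holds W y s′ s) (begin
    ∑ᵖ (λ b → move-unit p p′ b a + moves W b a)
      ≡⟨ ᵖ.∑-homo (λ b → move-unit p p′ b a) (λ b → moves W b a) ⟩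
    ∑ᵖ (λ b → move-unit p p′ b a) + ∑ᵖ (λ b → moves W b a)
      ≡⟨ ≡.cong (_+ ∑ᵖ (λ b → moves W b a))
           (∑-δ ∑ᵖ-sum _≟ᵖ_ {δ p′ a} p (proj₁ (arc-range arc))) ⟩
    δ p′ a + ∑ᵖ (λ b → moves W b a) ∎)
  entering-◅ (waiting {x} {t} {t′} wait) W a@(y , s) = shiftʳ (δ (x , t′) a) (∑ᵖ λ b → moves W b a) (begin
    ∑ᵗ (λ s′ → hold-unit x t t′ y s′ s + holds W y s′ s)
      ≡⟨ ᵗ.∑-homo (λ s′ → hold-unit x t t′ y s′ s) (λ s′ → holds W y s′ s) ⟩
    ∑ᵗ (λ s′ → hold-unit x t t′ y s′ s) + ∑ᵗ (λ s′ → holds W y s′ s)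
      ≡⟨ ≡.cong (_+ ∑ᵗ (λ s′ → holds W y s′ s))
           (ᵗ.∑-when (x ≟X y) (λ s′ → (1 when (t′ ≟ᵗ s)) when (t ≟ᵗ s′))) ⟩
    (∑ᵗ (λ s′ → (1 when (t′ ≟ᵗ s)) when (t ≟ᵗ s′)) when (x ≟X y)) + ∑ᵗ (λ s′ → holds W y s′ s)
      ≡⟨ ≡.cong (λ m → (m when (x ≟X y)) + ∑ᵗ (λ s′ → holds W y s′ s))
           (∑-δ ∑ᵗ-sum _≟ᵗ_ {1 when (t′ ≟ᵗ s)} t (proj₁ (wait-range wait))) ⟩
    ((1 when (t′ ≟ᵗ s)) when (x ≟X y)) + ∑ᵗ (λ s′ → holds W y s′ s)
      ≡⟨ ≡.cong (_+ ∑ᵗ (λ s′ → holds W y s′ s)) (δ-componentwise x t′ y s) ⟨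
    δ (x , t′) a + ∑ᵗ (λ s′ → holds W y s′ s) ∎)

  -- Telescoping: each step adds its tail to `leaving` and its head to `entering`, and the inner
  -- nodes cancel. The end terms are placed so that no subtraction occurs.
  balance : ∀ {p q} (W : Walk p q) a → leaving W a + δ q a ≡ entering W a + δ p a
  balance stop (y , s) = refl
  balance {p} {q} (_◅_ {j = p′} st W) a = begin
    leaving (st ◅ W) a + δ q a       ≡⟨ ≡.cong (_+ δ q a) (leaving-◅ st W a) ⟩
    δ p a + leaving W a + δ q a      ≡⟨ ℕ.+-assoc (δ p a) (leaving W a) (δ q a) ⟩
    δ p a + (leaving W a + δ q a)    ≡⟨ ≡.cong (δ p a +_) (balance W a) ⟩
    δ p a + (entering W a + δ p′ a)  ≡⟨ x∙yz≈zy∙x (δ p a) (entering W a) (δ p′ a) ⟩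
    δ p′ a + entering W a + δ p a    ≡⟨ ≡.cong (_+ δ p a) (entering-◅ st W a) ⟨
    entering (st ◅ W) a + δ p a      ∎

  -- Links the duration constraint, a sum over all arcs, to a quantity that can be bounded step by
  -- step along the walk.
  length-∑ : ∀ {p q} (W : Walk p q) → ∑ᵖ (λ a → ∑ᵖ λ b → weight a b * moves W a b) ≡ length W
  length-∑ stop = begin
    ∑ᵖ (λ a → ∑ᵖ λ b → weight a b * 0)
      ≡⟨ ᵖ².∑-cong (λ (a , b) _ → ℕ.*-zeroʳ (weight a b)) ⟩
    ∑ᵖ (λ a → ∑ᵖ λ b → 0)               ≡⟨ ᵖ².∑-zero ⟩
    0                                     ∎
  length-∑ (moving {p} {p′} arc ◅ W) = begin
    ∑ᵖ (λ a → ∑ᵖ λ b → weight a b * (move-unit p p′ a b + moves W a b))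
      ≡⟨ ᵖ².∑-cong (λ (a , b) _ → ℕ.*-distribˡ-+ (weight a b) (move-unit p p′ a b) (moves W a b)) ⟩
    ∑ᵖ (λ a → ∑ᵖ λ b → weight a b * move-unit p p′ a b + weight a b * moves W a b)
      ≡⟨ ᵖ².∑-homo (λ (a , b) → weight a b * move-unit p p′ a b) (λ (a , b) → weight a b * moves W a b) ⟩
    ∑ᵖ (λ a → ∑ᵖ λ b → weight a b * move-unit p p′ a b) + ∑ᵖ (λ a → ∑ᵖ λ b → weight a b * moves W a b)
      ≡⟨ ≡.cong₂ _+_ (ᵖ².single (p , p′) ((proj₁ (arc-range arc)) , (proj₂ (arc-range arc))) off)
           (length-∑ W) ⟩
    weight p p′ * move-unit p p′ p p′ + length W
      ≡⟨ ≡.cong (_+ length W) (≡.trans (≡.cong (weight p p′ *_)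
           (≡.trans (when-true (p ≟ᵖ p) refl) (when-true (p′ ≟ᵖ p′) refl))) (ℕ.*-identityʳ _)) ⟩
    weight p p′ + length W ∎
    where
    off : ∀ ab → ab ≢ (p , p′) → weight (proj₁ ab) (proj₂ ab) * move-unit p p′ (proj₁ ab) (proj₂ ab) ≡ 0
    off (a , b) ab≢ = ≡.trans (≡.cong (weight a b *_)
      (when-false (p ≟ᵖ a) λ { refl → when-false (p′ ≟ᵖ b) λ { refl → ⊥-elim (ab≢ refl) } }))
      (ℕ.*-zeroʳ (weight a b))
  length-∑ (waiting _ ◅ W) = length-∑ W

  moves-support : ∀ {p q} (W : Walk p q) a b → moves W a b ≡ 0 ⊎ Arc a b
  moves-support stop a b = inj₁ refl
  moves-support (moving {p} {p′} arc ◅ W) a b with p ≟ᵖ a | p′ ≟ᵖ b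
  ... | yes refl | yes refl = inj₂ arc
  ... | yes _    | no _     = moves-support W a b
  ... | no _     | _        = moves-support W a b
  moves-support (waiting _ ◅ W) a b = moves-support W a b

  holds-support : ∀ {p q} (W : Walk p q) y s s′ → holds W y s s′ ≡ 0 ⊎ Wait y s s′
  holds-support stop y s s′ = inj₁ refl
  holds-support (moving _ ◅ W) y s s′ = holds-support W y s s′
  holds-support (waiting {x} {t} {t′} wait ◅ W) y s s′ with x ≟X y | t ≟ᵗ s | t′ ≟ᵗ s′
  ... | yes refl | yes refl | yes refl = inj₂ wait
  ... | yes _    | yes _    | no _     = holds-support W y s s′
  ... | yes _    | no _     | _        = holds-support W y s s′
  ... | no _     | _        | _        = holds-support W y s s′

  -- Simple walks and removal of cycles

  Departs : ∀ {p q} → X × ℕ → Walk p q → Set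
  Departs a stop              = ⊥
  Departs a (_◅_ {i = p} _ W) = p ≡ a ⊎ Departs a W

  -- Only departures are required to be distinct; the end node may have been passed before. This is
  -- what 0/1 values of the arc variables call for.
  Simple : ∀ {p q} → Walk p q → Set
  Simple stop              = ⊤
  Simple (_◅_ {i = p} _ W) = ¬ Departs p W × Simple W

  moves-undeparted : ∀ {p q} (W : Walk p q) {a} b → ¬ Departs a W → moves W a b ≡ 0
  moves-undeparted stop b _ = refl
  moves-undeparted (moving {p} {p′} _ ◅ W) {a} b ¬dep =
    ≡.cong₂ _+_ (when-false (p ≟ᵖ a) (⊥-elim ∘ ¬dep ∘ inj₁)) (moves-undeparted W b (¬dep ∘ inj₂))
  moves-undeparted (waiting _ ◅ W) b ¬dep = moves-undeparted W b (¬dep ∘ inj₂)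

  holds-undeparted : ∀ {p q} (W : Walk p q) {y s} s′ → ¬ Departs (y , s) W → holds W y s s′ ≡ 0
  holds-undeparted stop s′ _ = refl
  holds-undeparted (moving _ ◅ W) s′ ¬dep = holds-undeparted W s′ (¬dep ∘ inj₂)
  holds-undeparted (waiting {x} {t} {t′} _ ◅ W) {y} {s} s′ ¬dep = ≡.cong₂ _+_
    (when-false (x ≟X y) λ { refl → when-false (t ≟ᵗ s) λ { refl → ⊥-elim (¬dep (inj₁ refl)) } })
    (holds-undeparted W s′ (¬dep ∘ inj₂))

  -- An arc can be used again only by departing from its tail again.
  moves-binary : ∀ {p q} (W : Walk p q) → Simple W → ∀ a b → moves W a b ≡ 0 ⊎ moves W a b ≡ 1
  moves-binary stop _ a b = inj₁ refl
  moves-binary (moving {p} {p′} _ ◅ W) (¬dep , simple) a b with p ≟ᵖ a | p′ ≟ᵖ b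
  ... | yes refl | yes _ = inj₂ (≡.cong ℕ.suc (moves-undeparted W b ¬dep))
  ... | yes _    | no _  = moves-binary W simple a b
  ... | no _     | _     = moves-binary W simple a b
  moves-binary (waiting _ ◅ W) (_ , simple) a b = moves-binary W simple a b

  holds-binary : ∀ {p q} (W : Walk p q) → Simple W → ∀ y s s′ → holds W y s s′ ≡ 0 ⊎ holds W y s s′ ≡ 1
  holds-binary stop _ y s s′ = inj₁ refl
  holds-binary (moving _ ◅ W) (_ , simple) y s s′ = holds-binary W simple y s s′
  holds-binary (waiting {x} {t} {t′} _ ◅ W) (¬dep , simple) y s s′ with x ≟X y | t ≟ᵗ s | t′ ≟ᵗ s′
  ... | yes refl | yes refl | yes _ = inj₂ (≡.cong ℕ.suc (holds-undeparted W s′ ¬dep))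
  ... | yes _    | yes _    | no _  = holds-binary W simple y s s′
  ... | yes _    | no _     | _     = holds-binary W simple y s s′
  ... | no _     | _        | _     = holds-binary W simple y s s′

  length-◅ : ∀ {p p′ q} (st : Step p p′) (W : Walk p′ q) → length W ≤ length (st ◅ W)
  length-◅ (moving _)  W = ℕ.m≤n+m _ _
  length-◅ (waiting _) W = ℕ.≤-refl

  length-◅-mono : ∀ {p p′ q} (st : Step p p′) {W W′ : Walk p′ q} →
                  length W′ ≤ length W → length (st ◅ W′) ≤ length (st ◅ W)
  length-◅-mono (moving _)  le = ℕ.+-monoʳ-≤ _ le
  length-◅-mono (waiting _) le = le

  SimpleBelow : X × ℕ → X × ℕ → ℕ → Set
  SimpleBelow p q m = ∃ λ (W : Walk p q) → Simple W × length W ≤ m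

  -- If the walk departs from `a`, its suffix from there on is again simple and no longer.
  cut : ∀ {p q} a (W : Walk p q) → Simple W → ¬ Departs a W ⊎ SimpleBelow a q (length W)
  cut a stop _ = inj₁ λ ()
  cut a (_◅_ {i = p} st W) (¬dep , simple) with p ≟ᵖ a | cut a W simple
  ... | yes refl | _                        = inj₂ (st ◅ W , (¬dep , simple) , ℕ.≤-refl)
  ... | no _     | inj₂ (W′ , simple′ , le) = inj₂ (W′ , simple′ , ℕ.≤-trans le (length-◅ st W))
  ... | no p≢a   | inj₁ ¬dep′               = inj₁ λ { (inj₁ p≡a) → p≢a p≡a ; (inj₂ dep) → ¬dep′ dep }

  -- The rest of the walk is simplified first. If it returns to `p`, the walk starts at that
  -- departure instead, which drops the cycle; weights are natural numbers, so the length does not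
  -- grow.
  simplify : ∀ {p q} (W : Walk p q) → SimpleBelow p q (length W)
  simplify stop = stop , tt , z≤n
  simplify (_◅_ {i = p} st W) with simplify W
  ... | W′ , simple , le with cut p W′ simple
  ...   | inj₁ ¬dep = st ◅ W′ , (¬dep , simple) , length-◅-mono st {W} {W′} le
  ...   | inj₂ (W″ , simple″ , le″) =
    W″ , simple″ , ℕ.≤-trans le″ (ℕ.≤-trans le (length-◅ st W))

-- Integer differences of natural numbers

⊖≡0⇒≡ : ∀ m n → m ⊖ n ≡ 0ℤ → m ≡ n
⊖≡0⇒≡ ℕ.zero    ℕ.zero    _  = refl
⊖≡0⇒≡ (ℕ.suc m) (ℕ.suc n) eq =
  ≡.cong ℕ.suc (⊖≡0⇒≡ m n (≡.trans (≡.sym (ℤ.[1+m]⊖[1+n]≡m⊖n m n)) eq))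

⊖≡1⇒≡suc : ∀ m n → m ⊖ n ≡ 1ℤ → m ≡ ℕ.suc n
⊖≡1⇒≡suc ℕ.zero    ℕ.zero    ()
⊖≡1⇒≡suc ℕ.zero    (ℕ.suc n) ()
⊖≡1⇒≡suc (ℕ.suc m) n eq = ≡.cong ℕ.suc (⊖≡0⇒≡ m n (go m n eq))
  where
  go : ∀ m n → ℕ.suc m ⊖ n ≡ 1ℤ → m ⊖ n ≡ 0ℤ
  go ℕ.zero    ℕ.zero    _  = refl
  go ℕ.zero    (ℕ.suc ℕ.zero) ()
  go ℕ.zero    (ℕ.suc (ℕ.suc n)) ()
  go (ℕ.suc m) ℕ.zero    ()
  go (ℕ.suc m) (ℕ.suc n) eq = ≡.trans (ℤ.[1+m]⊖[1+n]≡m⊖n m n)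
    (go m n (≡.trans (≡.sym (ℤ.[1+m]⊖[1+n]≡m⊖n (ℕ.suc m) n)) eq))

suc-⊖ : ∀ n → ℕ.suc n ⊖ n ≡ 1ℤ
suc-⊖ ℕ.zero    = refl
suc-⊖ (ℕ.suc n) = ≡.trans (ℤ.[1+m]⊖[1+n]≡m⊖n (ℕ.suc n) n) (suc-⊖ n)

⊖-suc : ∀ n → n ⊖ ℕ.suc n ≡ -1ℤ
⊖-suc ℕ.zero    = refl
⊖-suc (ℕ.suc n) = ≡.trans (ℤ.[1+m]⊖[1+n]≡m⊖n n (ℕ.suc n)) (⊖-suc n)

≤-⊖ : ∀ {m n o} → m + n ≤ o → ℤ.+ m ℤ.≤ o ⊖ n
≤-⊖ {m} {n} {o} m+n≤o = ≡.subst (ℤ.+ m ℤ.≤_) (≡.sym (ℤ.⊖-≥ (ℕ.m+n≤o⇒n≤o m m+n≤o)))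
  (ℤ.+≤+ (ℕ.m+n≤o⇒m≤o∸n m m+n≤o))

-- The induced solution of SND-RR(G_S)

module _ {a ℓ₁ ℓ₂} {R : OrderedAbelianGroup a ℓ₁ ℓ₂} {I : Instance R} (P : ValidPartition I) where
  open Instance I
  open ValidPartition P
  open Auxiliary P

  module NetworkSums {c ℓ₁ ℓ₂} (M : PreorderedMonoid c ℓ₁ ℓ₂) where
    open OrderedSums M public hiding (_when_)
    open Sums (PreorderedMonoid.commutativeMonoid M) public

    -- The trivial conditions on node and copy are removed from the nested sum, which leaves the
    -- condition on time in the form that `Walks` expects.
    ∑ⱽ-sum : IsSummation (λ (_ , t) → t ≤ T) ∑ⱽ
    ∑ⱽ-sum = record
      { ∑-cong = λ eq → ∑-cong λ (x , t) (_ , t≤) → eq (x , t) t≤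
      ; ∑-mono = λ le → ∑-mono λ (x , t) (_ , t≤) → le (x , t) t≤
      ; ∑-homo = ∑-homo ; ∑-zero = ∑-zero
      ; single = λ {g} p t≤ → single {g} p (_ , t≤)
      ; ∑-swap = ∑-swap
      ; search = λ P⊎Q → [ inj₁ , (λ q → inj₂ λ p t≤ → q p (_ , t≤)) ]′ (search P⊎Q) }
      where
      open IsSummation (nested-sum (nested-sum (fin-sum n) λ v → fin-sum (ℕ.suc (size v))) λ _ → range-sum T)

    ∑ᴺ-sum : IsSummation _ ∑ᴺ
    ∑ᴺ-sum = nested-sum (fin-sum n) λ _ → range-sum T

    ∑ⱽ²-sum : IsSummation _ (λ g → ∑ⱽ λ p → ∑ⱽ λ p′ → g (p , p′))
    ∑ⱽ²-sum = nested-sum ∑ⱽ-sum λ _ → ∑ⱽ-sum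

    ∑ᴺ²-sum : IsSummation _ (λ g → ∑ᴺ λ a → ∑ᴺ λ b → g (a , b))
    ∑ᴺ²-sum = nested-sum ∑ᴺ-sum λ _ → ∑ᴺ-sum

  open NetworkSums +-≤-monoid

  transit : TNode → TNode → ℕ
  transit p p′ = τ (proj₁ (proj₁ p)) (proj₁ (proj₁ p′))

  abstract
    _≟ᵀ_ : DecidableEquality TNode
    _≟ᵀ_ = ≡-dec _≟V_ ℕ._≟_

    _≟ᵀ²_ : DecidableEquality (TNode × TNode)
    _≟ᵀ²_ = ≡-dec _≟ᵀ_ _≟ᵀ_

    _≟ᴰ²_ : DecidableEquality (DNode × DNode)
    _≟ᴰ²_ = ≡-dec (≡-dec Fin._≟_ ℕ._≟_) (≡-dec Fin._≟_ ℕ._≟_)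

  E⇒A : ∀ {x z} → E x z → proj₁ z ∈ A (proj₁ x)
  E⇒A {_ , Fin.zero}  z∈ = ⊥-elim (∉⊥ z∈)
  E⇒A {v , Fin.suc i} z∈ = part⊆A v i z∈

  -- The copy of v whose part contains vw; v⁰ (a junk value) if vw is not an arc.
  copy : Fin n → Fin n → V
  copy v w with w ∈? A v
  ... | yes w∈ = v , Fin.suc (proj₁ (part-covers w∈))
  ... | no _   = v , Fin.zero

  -- Parts are disjoint, so the tail copy of an arc of `G` can be recovered from the underlying arc
  -- of `D`. This makes the rounding `ψ` on `D` agree with `φ` on tails.
  copy-unique : ∀ {x z} → E x z → copy (proj₁ x) (proj₁ z) ≡ x
  copy-unique {_ , Fin.zero} z∈ = ⊥-elim (∉⊥ z∈)
  copy-unique {v , Fin.suc i} {w , _} z∈ with w ∈? A v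
  ... | yes w∈ = ≡.cong (λ j → v , Fin.suc j) (part-disjoint v (proj₂ (part-covers w∈)) z∈)
  ... | no w∉  = contradiction (part⊆A v i z∈) w∉

  -- Downward search from `b`, which ends at the latest at time 0. For nodes of `V_S` the start
  -- condition of (P1′) supplies `Q 0`.
  latest : ∀ {Q : Pred ℕ 0ℓ} → Decidable Q → Q 0 → ∀ b → ∃ (IsLatest Q b)
  latest Q? q₀ ℕ.zero = 0 , z≤n , q₀ , λ s≤0 _ → s≤0
  latest Q? q₀ (ℕ.suc b) with Q? (ℕ.suc b)
  ... | yes q = ℕ.suc b , ℕ.≤-refl , q , λ s≤ _ → s≤
  ... | no ¬q with latest Q? q₀ b
  ...   | m , m≤b , q , max = m , ℕ.m≤n⇒m≤1+n m≤b , q , λ s≤ qs →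
    [ (λ s<1+b → max (ℕ.s≤s⁻¹ s<1+b) qs) , (λ { refl → contradiction qs ¬q }) ]′ (ℕ.m≤n⇒m<n∨m≡n s≤)

  IsLatest-unique : ∀ {Q : Pred ℕ 0ℓ} {b m m′} → IsLatest Q b m → IsLatest Q b m′ → m ≡ m′
  IsLatest-unique (m≤ , q , max) (m′≤ , q′ , max′) = ℕ.≤-antisym (max′ m≤ q) (max m′≤ q′)

  module Relaxation (G : PartialNetwork) (p1 : PartialNetwork.P1′ G) (p2 : PartialNetwork.P2′ G)
    (X : Variables) (X-feasible : Program.Feasible G_T X) where

    open PartialNetwork G
    open Variables X
    module F = Program.Feasible X-feasible
    module Full = Program G_T
    module Partial = Program timed
    module p1 = P1′ p1

    -- Rounding of times and arcs

    ρ : V → ℕ → ℕ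
    ρ x b = proj₁ (latest (λ t → V_S? (x , t)) (p1.start x) b)

    ρ-latest : ∀ x b → IsLatest (λ t → V_S (x , t)) b (ρ x b)
    ρ-latest x b = proj₂ (latest (λ t → V_S? (x , t)) (p1.start x) b)

    ρ≤ : ∀ x b → ρ x b ≤ b
    ρ≤ x b = proj₁ (ρ-latest x b)

    ρᴺ : Fin n → ℕ → ℕ
    -- The terminal copy at time 0 witnesses that `v` occurs in `N_S` at time 0.
    ρᴺ v b = proj₁ (latest (λ t → N_S? (v , t)) (Fin.zero , p1.start _) b)

    ρᴺ-latest : ∀ v b → IsLatest (λ t → N_S (v , t)) b (ρᴺ v b)
    ρᴺ-latest v b = proj₂ (latest (λ t → N_S? (v , t)) (Fin.zero , p1.start _) b)

    -- Time rounding of the movement arcs of G_T (φ) and of the arcs of D_T (ψ).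
    φ : TNode × TNode → TNode × TNode
    φ ((x , t) , (z , _)) = (x , ρ x t) , (z , ρ z (ρ x t + τ (proj₁ x) (proj₁ z)))

    ψ : DNode × DNode → DNode × DNode
    ψ ((v , t) , (w , _)) = (v , ρ (copy v w) t) , (w , ρᴺ w (ρ (copy v w) t + τ v w))

    Carries : Commodity → Pred (TNode × TNode) 0ℓ
    Carries k e = Full.Moveᵏ k (proj₁ e) (proj₂ e) × move k (proj₁ e) (proj₂ e) ≡ 1

    -- Each arc of the walk keeps a used arc of `G_T` from which it arose. Loads and costs can then
    -- still be compared after cycles have been cut out.
    Arc : Commodity → Rel TNode 0ℓ
    Arc k p p′ = Partial.Moveᵏ k p p′ × ∃ λ e → Carries k e × φ e ≡ (p , p′)

    -- Rounding the tail to an earlier time keeps the arrival within the horizon, so (P2′) applies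
    -- at the rounded tail.
    φ-arc : ∀ {x t z t′} → E x z → t + τ (proj₁ x) (proj₁ z) ≤ T →
            E_S (proj₁ (φ ((x , t) , (z , t′)))) (proj₂ (φ ((x , t) , (z , t′))))
    φ-arc {x} {t} {z} xz t+τ≤T = p2 xz (proj₁ (proj₂ (ρ-latest x t)))
      (ℕ.≤-trans (ℕ.+-monoˡ-≤ _ (ρ≤ x t)) t+τ≤T) (ρ-latest z _)

    φ-time : ∀ x t z → ρ z (ρ x t + τ (proj₁ x) (proj₁ z)) ≤ t + τ (proj₁ x) (proj₁ z)
    φ-time x t z = ℕ.≤-trans (ρ≤ z _) (ℕ.+-monoˡ-≤ _ (ρ≤ x t))

    Arc-range : ∀ k {x t z s} → Arc k (x , t) (z , s) → t ≤ T × s ≤ T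
    Arc-range k ((e , _) , _) with E_S-arc e
    ... | t≤T , _ , s≤ , ≤T = t≤T , ℕ.≤-trans s≤ ≤T

    Wait-range : ∀ k {x t s} → Partial.Holdᵏ k x t s → t ≤ T × s ≤ T
    Wait-range k ((t∈ , s∈ , _) , _) = V_S⊆V_T t∈ , V_S⊆V_T s∈

    module W k = Walks _≟V_ {T} ∑ⱽ-sum (range-sum T) (Arc k) (Partial.Holdᵏ k)
                       (Arc-range k) (Wait-range k) transit
    open W using (Walk; length; moving; waiting)

    -- Walks that follow the flow of a commodity

    origin destination : Commodity → TNode
    origin k      = o′ k , r k
    destination k = d⁰ k , l k

    -- Holdover arcs are prepended backwards: from `s′` to the copy of `x` just before it, which by
    -- maximality is not before `s`, and so on. `N` bounds `s′` for termination; waiting adds no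
    -- length.
    wait : ∀ k {x q} → Vᵏ k x → ∀ N s s′ → s′ ≤ N → V_S (x , s) → V_S (x , s′) → s ≤ s′ →
           (W : Walk k (x , s′) q) → ∃ λ (W′ : Walk k (x , s) q) → length k W′ ≤ length k W
    wait k {x} x∈ N s s′ s′≤N s∈ s′∈ s≤s′ W with ℕ.m≤n⇒m<n∨m≡n s≤s′
    wait k {x} x∈ N s s′ s′≤N s∈ s′∈ s≤s′ W | inj₂ refl = W , ℕ.≤-refl
    wait k {x} x∈ (ℕ.suc N) s (ℕ.suc s″) (s≤s s″≤N) s∈ s′∈ _ W | inj₁ (s≤s s≤s″) =
      wait k x∈ N s m (ℕ.≤-trans m≤s″ s″≤N) s∈ m∈ (max s≤s″ s∈)
           (waiting ((m∈ , s′∈ , s≤s m≤s″ , λ { (s≤s ≤s″) → max ≤s″ }) , x∈) ◅ W)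
      where
      m = ρ x s″
      m≤s″ = proj₁ (ρ-latest x s″)
      m∈ = proj₁ (proj₂ (ρ-latest x s″))
      max : ∀ {s} → s ≤ s″ → V_S (x , s) → s ≤ m
      max = proj₂ (proj₂ (ρ-latest x s″))

    -- The condition under which the flow in `G_T` can be followed further: away from the
    -- destination, balance then forces flow out of the node.
    Live : Commodity → Pred TNode 0ℓ
    Live k p = 0 < Full.inflow X k p ⊎ p ≡ origin k

    -- By balance, outflow exceeds inflow by one at the origin and equals it at nodes other than the
    -- two terminals.
    live⇒outflow : ∀ k p → Full.Nodeᵏ k p → p ≢ destination k → Live k p → 0 < Full.outflow X k p
    live⇒outflow k p p∈ p≢d live with p ≟ᵀ origin k | live
    ... | yes p≡o | _ = ≡.subst (0 <_)
      (≡.sym (⊖≡1⇒≡suc (Full.outflow X k p) (Full.inflow X k p) (F.balance-origin k p p∈ p≡o))) (s≤s z≤n)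
    ... | no p≢o  | inj₁ 0<in = ≡.subst (0 <_)
      (≡.sym (⊖≡0⇒≡ (Full.outflow X k p) (Full.inflow X k p) (F.balance-otherwise k p p∈ p≢o p≢d))) 0<in
    ... | no p≢o  | inj₂ p≡o  = contradiction p≡o p≢o

    when⇒ : ∀ {Q : Set} {m} (Q? : Dec Q) → (m when Q?) ≢ 0 → Q × m ≢ 0
    when⇒ (yes q) m≢0 = q , m≢0
    when⇒ (no _)  0≢0 = contradiction refl 0≢0

    decide : ∀ m → m ≢ 0 ⊎ m ≡ 0
    decide ℕ.zero    = inj₂ refl
    decide (ℕ.suc m) = inj₁ λ ()

    summand : ∀ {J : Set} {In : Pred J 0ℓ} {∑ : (J → ℕ) → ℕ} → IsSummation In ∑ →
              ∀ g → (∑ g ≡ 0) ⊎ ∃ λ j → g j ≢ 0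
    summand ∑-sum g with IsSummation.search ∑-sum {λ j → g j ≢ 0} {λ j → g j ≡ 0} (λ j → decide (g j))
    ... | inj₁ found = inj₂ found
    ... | inj₂ zeros = inj₁ (≡.trans (IsSummation.∑-cong ∑-sum zeros) (IsSummation.∑-zero ∑-sum))

    ≢0⇒≡1 : ∀ {m} → m ≡ 0 ⊎ m ≡ 1 → m ≢ 0 → m ≡ 1
    ≢0⇒≡1 (inj₁ m≡0) m≢0 = contradiction m≡0 m≢0
    ≢0⇒≡1 (inj₂ m≡1) _   = m≡1

    data Departure (k : Commodity) : TNode → Set where
      by-move : ∀ {p p′} → Carries k (p , p′) → Departure k p
      by-hold : ∀ {x t t′} → Full.Holdᵏ k x t t′ → hold k x t t′ ≡ 1 → Departure k (x , t)

    departure : ∀ k p → 0 < Full.outflow X k p → Departure k p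
    departure k (x , t) 0<out
      with summand ∑ⱽ-sum (λ p → move k (x , t) p when Full.Moveᵏ? k (x , t) p)
         | summand (range-sum T) (λ s → hold k x t s when Full.Holdᵏ? k x t s)
    ... | inj₂ (p , ≢0) | _ with when⇒ (Full.Moveᵏ? k (x , t) p) ≢0
    ...   | m∈ , m≢0 = by-move (m∈ , ≢0⇒≡1 (F.move-binary k _ _) m≢0)
    departure k (x , t) 0<out | inj₁ _ | inj₂ (s , ≢0) with when⇒ (Full.Holdᵏ? k x t s) ≢0
    ...   | h∈ , h≢0 = by-hold h∈ (≢0⇒≡1 (F.hold-binary k _ _ _) h≢0)
    departure k (x , t) 0<out | inj₁ eq | inj₁ eq′ =
      contradiction (≡.subst (0 <_) (≡.cong₂ _+_ eq eq′) 0<out) λ ()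

    move⇒inflow : ∀ k {p z t′} → p .proj₂ ≤ T → Carries k (p , (z , t′)) → 0 < Full.inflow X k (z , t′)
    move⇒inflow k {p} {z} {t′} t≤T (m∈ , m≡1) = ℕ.m≤n⇒m≤n+o (∑ᵗ λ s → hold k z s t′ when Full.Holdᵏ? k z s t′)
      (≡.subst (_≤ ∑ⱽ g) (≡.trans (when-true (Full.Moveᵏ? k p (z , t′)) m∈) m≡1)
               (term≤∑ ∑ⱽ-sum _≟ᵀ_ {g} (λ _ → z≤n) p t≤T))
      where
      g : TNode → ℕ
      g p = move k p (z , t′) when Full.Moveᵏ? k p (z , t′)

    hold⇒inflow : ∀ k {x t t′} → t ≤ T → Full.Holdᵏ k x t t′ → hold k x t t′ ≡ 1 →
                  0 < Full.inflow X k (x , t′)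
    hold⇒inflow k {x} {t} {t′} t≤T h∈ h≡1 = ℕ.m≤n⇒m≤o+n (∑ⱽ λ p → move k p (x , t′) when Full.Moveᵏ? k p (x , t′))
      (≡.subst (_≤ ∑ᵗ g) (≡.trans (when-true (Full.Holdᵏ? k x t t′) h∈) h≡1)
               (term≤∑ (range-sum T) ℕ._≟_ {g} (λ _ → z≤n) t t≤T))
      where
      g : ℕ → ℕ
      g t = hold k x t t′ when Full.Holdᵏ? k x t t′

    -- `t` is the clock of the walk in `G_T`, kept apart from the time of `p`: the remaining transit
    -- time must fit between `t` and the deadline.
    Route : Commodity → TNode → ℕ → Set
    Route k p t = ∃ λ (W : Walk k p (destination k)) → length k W + t ≤ l k

    delay : ∀ k {x s s′ t} → Vᵏ k x → V_S (x , s) → V_S (x , s′) → s ≤ s′ →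
            Route k (x , s′) t → Route k (x , s) t
    delay k {s = s} {s′} {t} x∈ s∈ s′∈ s≤s′ (W , W≤) with wait k x∈ s′ s s′ ℕ.≤-refl s∈ s′∈ s≤s′ W
    ... | W′ , W′≤ = W′ , ℕ.≤-trans (ℕ.+-monoˡ-≤ t W′≤) W≤

    -- Invariant: the walk in G_S is never later than the one in G_T, standing at (x , s)
    -- with s ≤ t while the latter stands at (x , t).  N bounds the remaining time T − t.
    trace : ∀ k N {x t} s → T < N + t → t ≤ T → s ≤ t → V_S (x , s) → Vᵏ k x → Live k (x , t) →
            Route k (x , s) t
    trace k ℕ.zero s T<t t≤T _ _ _ _ = contradiction t≤T (ℕ.<⇒≱ T<t)
    trace k (ℕ.suc N) {x} {t} s T<N+t t≤T s≤t s∈ x∈ live with (x , t) ≟ᵀ destination k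
    -- Only waiting remains, since (P1′) puts the destination at its deadline into `V_S`.
    ... | yes refl = delay k x∈ s∈ (p1.destination k) s≤t (stop , ℕ.≤-refl)
    ... | no ≢d with departure k (x , t) (live⇒outflow k (x , t) (t≤T , x∈) ≢d live)
    -- A holdover in `G_T` only advances the clock; the walk in `G_S` stays at `(x , s)`.
    ...   | by-hold h∈@((refl , t′≤T) , _) h≡1 with
      trace k N s (≡.subst (T <_) (≡.sym (ℕ.+-suc N t)) T<N+t) t′≤T (ℕ.m≤n⇒m≤1+n s≤t) s∈ x∈
            (inj₁ (hold⇒inflow k t≤T h∈ h≡1))
    ...     | W , W≤ = W , ℕ.≤-trans (ℕ.+-monoʳ-≤ (length k W) (ℕ.n≤1+n t)) W≤
    trace k (ℕ.suc N) {x} {t} s T<N+t t≤T s≤t s∈ x∈ live | no ≢d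
          | by-move {p′ = z , _} c@(((xz , refl , t′≤T) , ezz@(_ , _ , z∈)) , _) =
      -- Wait until the rounded time `ρ x t`, then take the rounded arc. Its transit time is exactly
      -- the advance of the clock in `G_T`.
      delay k x∈ s∈ ρ∈ (max s≤t s∈) (moving arc ◅ proj₁ rest , (begin
        step + length k (proj₁ rest) + t    ≡⟨ ≡.cong (_+ t) (ℕ.+-comm step _) ⟩
        length k (proj₁ rest) + step + t    ≡⟨ ℕ.+-assoc (length k (proj₁ rest)) step t ⟩
        length k (proj₁ rest) + (step + t)  ≡⟨ ≡.cong (length k (proj₁ rest) +_) (ℕ.+-comm step t) ⟩
        length k (proj₁ rest) + (t + step)  ≤⟨ proj₂ rest ⟩
        l k                              ∎))
      where
      open ℕ.≤-Reasoning
      step = τ (proj₁ x) (proj₁ z)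
      ρ∈ = proj₁ (proj₂ (ρ-latest x t))
      max : ∀ {s} → s ≤ t → V_S (x , s) → s ≤ ρ x t
      max = proj₂ (proj₂ (ρ-latest x t))
      arc : Arc k (x , ρ x t) (z , ρ z (ρ x t + step))
      arc = (φ-arc {t′ = t + step} xz t′≤T , ezz) , _ , c , refl
      rest : Route k (z , ρ z (ρ x t + step)) (t + step)
      -- The transit time is positive, so the clock advances by at least one and `N` still bounds
      -- the remaining time.
      rest = trace k N _ (ℕ.≤-trans T<N+t (begin
          ℕ.suc N + t    ≡⟨ ℕ.+-suc N t ⟨
          N + ℕ.suc t    ≡⟨ ≡.cong (N +_) (ℕ.+-comm 1 t) ⟩
          N + (t + 1)    ≤⟨ ℕ.+-monoʳ-≤ N (ℕ.+-monoʳ-≤ t (τ-pos (E⇒A {x} {z} xz))) ⟩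
          N + (t + step)    ∎))
        t′≤T (φ-time x t z) (proj₁ (proj₂ (ρ-latest z (ρ x t + step)))) z∈ (inj₁ (move⇒inflow k t≤T c))

    simple-route : ∀ k → ∃ λ (W : Walk k (origin k) (destination k)) →
                   W.Simple k W × length k W + r k ≤ l k
    -- `ℕ.suc T` is a sufficient bound for every release time, as `T < ℕ.suc T + r k`.
    simple-route k with trace k (ℕ.suc T) (r k) (s≤s (ℕ.m≤m+n T (r k))) (V_S⊆V_T (p1.origin k))
                          ℕ.≤-refl (p1.origin k) (o′∈Vᵏ k) (inj₂ refl)
    ... | W , W≤ with W.simplify k W
    ...   | W′ , simple , W′≤ = W′ , simple , ℕ.≤-trans (ℕ.+-monoˡ-≤ (r k) W′≤) W≤

    -- The induced solution, its balance and duration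

    route : ∀ k → Walk k (origin k) (destination k)
    route k = proj₁ (simple-route k)

    y′ : DNode → DNode → ℕ
    y′ a b = ∑ᴺ λ a′ → ∑ᴺ λ b′ →
      (y a′ b′ when TimedNetwork.Arcᴰ? G_T a′ b′) when (ψ (a′ , b′) ≟ᴰ² (a , b))

    Y : Variables
    Y = record { move = λ k → W.moves k (route k) ; hold = λ k → W.holds k (route k) ; y = y′ }

    moves-supportᵏ : ∀ k p p′ → ¬ Partial.Moveᵏ k p p′ → Variables.move Y k p p′ ≡ 0
    moves-supportᵏ k p p′ ∉ with W.moves-support k (route k) p p′
    ... | inj₁ eq      = eq
    ... | inj₂ (m∈ , _) = contradiction m∈ ∉

    holds-supportᵏ : ∀ k x t t′ → ¬ Partial.Holdᵏ k x t t′ → Variables.hold Y k x t t′ ≡ 0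
    holds-supportᵏ k x t t′ ∉ with W.holds-support k (route k) x t t′
    ... | inj₁ eq = eq
    ... | inj₂ h∈ = contradiction h∈ ∉

    when-supported : ∀ {Q : Set} {m} (Q? : Dec Q) → (¬ Q → m ≡ 0) → (m when Q?) ≡ m
    when-supported (yes _) _      = refl
    when-supported (no ¬q) vanish = ≡.sym (vanish ¬q)

    outflow-Y : ∀ k p → Partial.outflow Y k p ≡ W.leaving k (route k) p
    outflow-Y k (x , t) = ≡.cong₂ _+_
      (IsSummation.∑-cong ∑ⱽ-sum λ p _ → when-supported (Partial.Moveᵏ? k (x , t) p) (moves-supportᵏ k (x , t) p))
      (IsSummation.∑-cong (range-sum T) λ s _ → when-supported (Partial.Holdᵏ? k x t s) (holds-supportᵏ k x t s))

    inflow-Y : ∀ k p → Partial.inflow Y k p ≡ W.entering k (route k) p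
    inflow-Y k (x , t) = ≡.cong₂ _+_
      (IsSummation.∑-cong ∑ⱽ-sum λ p _ → when-supported (Partial.Moveᵏ? k p (x , t)) (moves-supportᵏ k p (x , t)))
      (IsSummation.∑-cong (range-sum T) λ s _ → when-supported (Partial.Holdᵏ? k x s t) (holds-supportᵏ k x s t))

    balance-Y : ∀ k p → Partial.outflow Y k p + W.δ k (destination k) p ≡
                        Partial.inflow Y k p + W.δ k (origin k) p
    balance-Y k p = ≡.trans (≡.cong (_+ W.δ k (destination k) p) (outflow-Y k p))
      (≡.trans (W.balance k (route k) p) (≡.cong (_+ W.δ k (origin k) p) (≡.sym (inflow-Y k p))))

    -- If they coincided, feasibility of `X` would require net flow 1 and -1 at the same node.
    origin≢destination : ∀ k → origin k ≢ destination k
    origin≢destination k o≡d = contradiction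
      (≡.trans (≡.sym (F.balance-origin k (origin k) o∈ refl)) (F.balance-destination k (origin k) o∈ o≡d)) λ ()
      where
      o∈ : Full.Nodeᵏ k (origin k)
      o∈ = V_S⊆V_T (p1.origin k) , o′∈Vᵏ k

    δ-refl : ∀ k p → W.δ k p p ≡ 1
    δ-refl k p = when-true (W._≟ᵖ_ k p p) refl

    δ-≢ : ∀ k {p q} → q ≢ p → W.δ k p q ≡ 0
    δ-≢ k {p} {q} q≢p = when-false (W._≟ᵖ_ k p q) λ p≡q → ⊥-elim (q≢p (≡.sym p≡q))

    ⊖-balance : ∀ {i j m n m′ n′ z} → i + m ≡ j + n → m ≡ m′ → n ≡ n′ →
                (∀ {i j} → i + m′ ≡ j + n′ → i ⊖ j ≡ z) → i ⊖ j ≡ z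
    ⊖-balance eq refl refl f = f eq

    supply-Y : ∀ k p → p ≡ origin k → Partial.netflow Y k p ≡ 1ℤ
    supply-Y k p refl = ⊖-balance {Partial.outflow Y k p} {Partial.inflow Y k p} (balance-Y k p)
      (δ-≢ k (origin≢destination k)) (δ-refl k p) λ {i} {j} eq →
      ≡.trans (≡.cong (_⊖ j) (≡.trans (≡.sym (ℕ.+-identityʳ i)) (≡.trans eq (ℕ.+-comm j 1)))) (suc-⊖ j)

    demand-Y : ∀ k p → p ≡ destination k → Partial.netflow Y k p ≡ -1ℤ
    demand-Y k p refl = ⊖-balance {Partial.outflow Y k p} {Partial.inflow Y k p} (balance-Y k p)
      (δ-refl k p) (δ-≢ k (origin≢destination k ∘ ≡.sym)) λ {i} {j} eq →
      ≡.trans (≡.cong (i ⊖_) (≡.trans (≡.sym (ℕ.+-identityʳ j)) (≡.trans (≡.sym eq) (ℕ.+-comm i 1)))) (⊖-suc i)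

    conservation-Y : ∀ k p → p ≢ origin k → p ≢ destination k → Partial.netflow Y k p ≡ 0ℤ
    conservation-Y k p ≢o ≢d = ⊖-balance {Partial.outflow Y k p} {Partial.inflow Y k p} (balance-Y k p)
      (δ-≢ k ≢d) (δ-≢ k ≢o) λ {i} {j} eq →
      ≡.trans (≡.cong (_⊖ j) (ℕ.+-cancelʳ-≡ 0 i j eq)) (ℤ.n⊖n≡0 j)

    duration-Y : ∀ k → Partial.duration Y k + r k ≤ l k
    duration-Y k = ℕ.≤-trans (ℕ.+-monoˡ-≤ (r k) (begin
      Partial.duration Y k
        ≤⟨ IsSummation.∑-mono ∑ⱽ²-sum
             {λ (p , p′) → transit p p′ * Variables.move Y k p p′ when Partial.Moveᵏ? k p p′}
             {λ (p , p′) → transit p p′ * Variables.move Y k p p′}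
             (λ (p , p′) _ → when-≤ (Partial.Moveᵏ? k p p′) z≤n) ⟩
      ∑ⱽ (λ p → ∑ⱽ λ p′ → transit p p′ * Variables.move Y k p p′)
        ≡⟨ W.length-∑ k (route k) ⟩
      length k (route k) ∎)) (proj₂ (proj₂ (simple-route k)))
      where
      open ℕ.≤-Reasoning

    -- Comparing sums over the routes with sums over the full flow

    Carries-range : ∀ k {p p′} → Full.Moveᵏ k p p′ → proj₂ p ≤ T × proj₂ p′ ≤ T
    Carries-range k ((_ , refl , t′≤T) , _) = ℕ.m+n≤o⇒m≤o _ t′≤T , t′≤T

    φ-range : ∀ k {e} → Full.Moveᵏ k (proj₁ e) (proj₂ e) →
              proj₂ (proj₁ (φ e)) ≤ T × proj₂ (proj₂ (φ e)) ≤ T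
    φ-range k {(x , t) , (z , _)} ((_ , refl , t′≤T) , _) =
      ℕ.≤-trans (ρ≤ x t) (ℕ.m+n≤o⇒m≤o _ t′≤T) , ℕ.≤-trans (φ-time x t z) t′≤T

    carries? : ∀ k e → Carries k e ⊎ move k (proj₁ e) (proj₂ e) ≡ 0
    carries? k (p , p′) with F.move-binary k p p′ | Full.Moveᵏ? k p p′
    ... | inj₁ m≡0 | _      = inj₂ m≡0
    ... | inj₂ m≡1 | yes m∈ = inj₁ (m∈ , m≡1)
    ... | inj₂ _   | no m∉  = inj₂ (F.move-support k p p′ m∉)

    -- Simplicity of the route gives the value 0 or 1, and the origin recorded in `Arc` gives the
    -- used arc of `G_T`.
    route-arc : ∀ k p p′ → Variables.move Y k p p′ ≡ 0 ⊎
                Variables.move Y k p p′ ≡ 1 × ∃ λ e → Carries k e × φ e ≡ (p , p′)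
    route-arc k p p′ with W.moves-binary k (route k) (proj₁ (proj₂ (simple-route k))) p p′
                        | W.moves-support k (route k) p p′
    ... | inj₁ m≡0 | _               = inj₁ m≡0
    ... | inj₂ _   | inj₁ m≡0        = inj₁ m≡0
    ... | inj₂ m≡1 | inj₂ (_ , arc)  = inj₂ (m≡1 , arc)

    module _ {c ℓ₁ ℓ₂} (M : PreorderedMonoid c ℓ₁ ℓ₂) where
      open PreorderedMonoid M using (Carrier; _≈_; _≼_; ≼-reflexive; sym) renaming (ε to 0#)
      private
        module S = NetworkSums M

      -- Treats loads and flow costs alike: `g` and `g′` give the contribution of an arc as a
      -- function of its flow. Each used arc of the route is charged to a used preimage under `φ`.
      route-dominated : ∀ k (g g′ : TNode × TNode → ℕ → Carrier) →
        (∀ e → g e 0 ≈ 0#) → (∀ e → g′ e 0 ≈ 0#) →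
        (∀ e → Full.Moveᵏ k (proj₁ e) (proj₂ e) → 0# ≼ g e 1) →
        (∀ e → Full.Moveᵏ k (proj₁ e) (proj₂ e) → g′ (φ e) 1 ≼ g e 1) →
        S.∑ⱽ (λ p → S.∑ⱽ λ p′ → g′ (p , p′) (Variables.move Y k p p′)) ≼
        S.∑ⱽ (λ p → S.∑ⱽ λ p′ → g (p , p′) (move k p p′))
      route-dominated k g g′ g0 g′0 g1 g′1≼g1 =
        S.∑-pushforward S.∑ⱽ²-sum S.∑ⱽ²-sum _≟ᵀ²_ _≟ᵀ²_ φ
          {λ e → g e (move k (proj₁ e) (proj₂ e))}
          {λ e → g′ e (Variables.move Y k (proj₁ e) (proj₂ e))}
          nonneg range dominated
        where
        nonneg : ∀ e → 0# ≼ g e (move k (proj₁ e) (proj₂ e))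
        nonneg e with carries? k e
        ... | inj₁ (m∈ , m≡1) = ≡.subst (λ m → 0# ≼ g e m) (≡.sym m≡1) (g1 e m∈)
        ... | inj₂ m≡0        = ≡.subst (λ m → 0# ≼ g e m) (≡.sym m≡0)
          (≼-reflexive (sym (g0 e)))

        range : ∀ e → _ → (proj₂ (proj₁ (φ e)) ≤ T × proj₂ (proj₂ (φ e)) ≤ T) ⊎
                g e (move k (proj₁ e) (proj₂ e)) ≈ 0#
        range e _ with carries? k e
        ... | inj₁ (m∈ , _) = inj₁ (φ-range k m∈)
        ... | inj₂ m≡0      = inj₂ (≡.subst (λ m → g e m ≈ 0#) (≡.sym m≡0) (g0 e))

        dominated : ∀ e′ → g′ e′ (Variables.move Y k (proj₁ e′) (proj₂ e′)) ≼ 0# ⊎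
          ∃ λ e → (proj₂ (proj₁ e) ≤ T × proj₂ (proj₂ e) ≤ T) × φ e ≡ e′ ×
            g′ e′ (Variables.move Y k (proj₁ e′) (proj₂ e′)) ≼ g e (move k (proj₁ e) (proj₂ e))
        dominated e′ with route-arc k (proj₁ e′) (proj₂ e′)
        ... | inj₁ m≡0 = inj₁ (≡.subst (λ m → g′ e′ m ≼ 0#) (≡.sym m≡0) (≼-reflexive (g′0 e′)))
        ... | inj₂ (m′≡1 , e , (m∈ , m≡1) , refl) = inj₂ (e , Carries-range k m∈ , refl ,
          ≡.subst₂ (λ m m′ → g′ (φ e) m ≼ g e m′) (≡.sym m′≡1) (≡.sym m≡1) (g′1≼g1 e m∈))

    -- Capacity constraints

    private
      Arcᴰ? = TimedNetwork.Arcᴰ? G_T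
      ℰᵀ? = TimedNetwork.ℰ? G_T
      ℰˢ? = TimedNetwork.ℰ? timed

    project : TNode × TNode → DNode × DNode
    project ((x , t) , (z , t′)) = (proj₁ x , t) , (proj₁ z , t′)

    -- By `copy-unique` the tails are rounded alike. The head of `φ e` may be earlier than `b`,
    -- since `ℰ_S` leaves its time free; `b` itself is determined as the latest node of `N_S`.
    ψ-project : ∀ {a b} k {e} → A_S a b → Full.Moveᵏ k (proj₁ e) (proj₂ e) →
                TimedNetwork.ℰ timed a b (proj₁ (φ e)) (proj₂ (φ e)) → ψ (project e) ≡ (a , b)
    ψ-project k {(x , t) , (z , t′)} (_ , _ , _ , b-latest) ((xz , _) , _) (_ , refl , refl , refl , _) =
      ≡.trans (≡.cong (λ x′ → (proj₁ x , ρ x′ t) , (proj₁ z , ρᴺ (proj₁ z) (ρ x′ t + τ (proj₁ x) (proj₁ z))))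
                      (copy-unique {x} {z} xz))
              (≡.cong (λ s → (proj₁ x , ρ x t) , (proj₁ z , s))
                      (IsLatest-unique (ρᴺ-latest (proj₁ z) _) b-latest))

    module _ (a b : DNode) (a∈ : A_S a b) where
      private
        share : DNode × DNode → Commodity × TNode × TNode → ℕ
        share (a′ , b′) (k , p , p′) =
          ((q k * move k p p′ when ℰᵀ? a′ b′ p p′) when Arcᴰ? a′ b′) when (ψ (a′ , b′) ≟ᴰ² (a , b))

        ∑ᴷ : (Commodity × TNode × TNode → ℕ) → ℕ
        ∑ᴷ g = sum λ k → ∑ⱽ λ p → ∑ⱽ λ p′ → g (k , p , p′)

        ∑ᴷ-sum : IsSummation _ ∑ᴷ
        ∑ᴷ-sum = nested-sum (fin-sum κ) λ _ → ∑ⱽ²-sum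

        -- The load that `(a , b)` would carry if every arc used in `G_T` were replaced by its
        -- image, with no cycles cut out.
        φ-load : ℕ
        φ-load = ∑ᴷ λ (k , e) → q k * move k (proj₁ e) (proj₂ e) when ℰˢ? a b (proj₁ (φ e)) (proj₂ (φ e))

      load≤φ-load : Partial.load Y a b ≤ φ-load
      load≤φ-load = IsSummation.∑-mono (fin-sum κ)
        {λ k → ∑ⱽ λ p → ∑ⱽ λ p′ → q k * Variables.move Y k p p′ when ℰˢ? a b p p′}
        {λ k → ∑ⱽ λ p → ∑ⱽ λ p′ →
          q k * move k p p′ when ℰˢ? a b (proj₁ (φ (p , p′))) (proj₂ (φ (p , p′)))} λ k _ →
        route-dominated +-≤-monoid k
          (λ e m → q k * m when ℰˢ? a b (proj₁ (φ e)) (proj₂ (φ e)))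
          (λ e m → q k * m when ℰˢ? a b (proj₁ e) (proj₂ e))
          (λ e → when-false (ℰˢ? a b (proj₁ (φ e)) (proj₂ (φ e))) λ _ → ℕ.*-zeroʳ (q k))
          (λ e → when-false (ℰˢ? a b (proj₁ e) (proj₂ e)) λ _ → ℕ.*-zeroʳ (q k))
          (λ _ _ → z≤n) (λ _ _ → ℕ.≤-refl)

      -- If `φ e` lies over `(a , b)`, then the flow on `e` is counted at `project e`, an arc of
      -- `D_T` that `ψ` rounds to `(a , b)`.
      φ-load≤shares : φ-load ≤ ∑ᴷ (λ i → ∑ᴺ λ a′ → ∑ᴺ λ b′ → share (a′ , b′) i)
      φ-load≤shares = IsSummation.∑-mono ∑ᴷ-sum
        {λ (k , e) → q k * move k (proj₁ e) (proj₂ e) when ℰˢ? a b (proj₁ (φ e)) (proj₂ (φ e))}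
        {λ i → ∑ᴺ λ a′ → ∑ᴺ λ b′ → share (a′ , b′) i}
        λ (k , e) _ → below k e (ℰˢ? a b (proj₁ (φ e)) (proj₂ (φ e))) (carries? k e)
        where
        below : ∀ k e (d : Dec (TimedNetwork.ℰ timed a b (proj₁ (φ e)) (proj₂ (φ e)))) →
                Carries k e ⊎ move k (proj₁ e) (proj₂ e) ≡ 0 →
                (q k * move k (proj₁ e) (proj₂ e) when d) ≤ ∑ᴺ λ a′ → ∑ᴺ λ b′ → share (a′ , b′) (k , e)
        below k e (no _)  _ = z≤n
        below k e (yes _) (inj₂ m≡0) =
          ≡.subst (_≤ ∑ᴺ λ a′ → ∑ᴺ λ b′ → share (a′ , b′) (k , e))
                  (≡.sym (≡.trans (≡.cong (q k *_) m≡0) (ℕ.*-zeroʳ (q k)))) z≤n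
        below k e@((x , t) , (z , t′)) (yes ∈ℰ) (inj₁ (m∈@((xz , t′≡ , t′≤T) , _) , _)) =
          ≡.subst (_≤ ∑ᴺ λ a′ → ∑ᴺ λ b′ → share (a′ , b′) (k , e)) (begin
              share (project e) (k , e)
                ≡⟨ when-true (ψ (project e) ≟ᴰ² (a , b)) (ψ-project k {e} a∈ m∈ ∈ℰ) ⟩
              ((q k * move k (x , t) (z , t′) when ℰᵀ? (proj₁ x , t) (proj₁ z , t′) (x , t) (z , t′))
                when Arcᴰ? (proj₁ x , t) (proj₁ z , t′))
                ≡⟨ when-true (Arcᴰ? (proj₁ x , t) (proj₁ z , t′)) (E⇒A {x} {z} xz , t′≡ , t′≤T) ⟩
              (q k * move k (x , t) (z , t′) when ℰᵀ? (proj₁ x , t) (proj₁ z , t′) (x , t) (z , t′))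
                ≡⟨ when-true (ℰᵀ? (proj₁ x , t) (proj₁ z , t′) (x , t) (z , t′)) (refl , refl , refl , refl , xz) ⟩
              q k * move k (x , t) (z , t′) ∎)
            (term≤∑ ∑ᴺ²-sum _≟ᴰ²_ {λ α → share α (k , e)} (λ _ → z≤n) (project e)
              ((tt , proj₁ (Carries-range k m∈)) , (tt , t′≤T)))
          where
          open ≡.≡-Reasoning

      -- Summing over commodities and arcs of `G` first gives the loads of the arcs of `D_T` in the
      -- fibre of `(a , b)`; their capacity constraints are then added up.
      shares≤y′ : ∑ᴷ (λ i → ∑ᴺ λ a′ → ∑ᴺ λ b′ → share (a′ , b′) i) ≤ u (proj₁ a) (proj₁ b) * y′ a b
      shares≤y′ = begin
        ∑ᴷ (λ i → ∑ᴺ λ a′ → ∑ᴺ λ b′ → share (a′ , b′) i)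
          ≡⟨ IsSummation.∑-swap ∑ᴷ-sum (IsSummation.additive ∑ᴺ²-sum) (λ i α → share α i) ⟩
        ∑ᴺ (λ a′ → ∑ᴺ λ b′ → ∑ᴷ (share (a′ , b′)))
          ≤⟨ IsSummation.∑-mono ∑ᴺ²-sum {λ α → ∑ᴷ (share α)} {λ α → υ * supply α} (λ α _ → bounded α) ⟩
        ∑ᴺ (λ a′ → ∑ᴺ λ b′ → υ * supply (a′ , b′))
          ≡⟨ IsSummation.∑-map ∑ᴺ²-sum {υ *_} scaling supply ⟩
        υ * y′ a b ∎
        where
        open ℕ.≤-Reasoning
        υ = u (proj₁ a) (proj₁ b)
        supply : DNode × DNode → ℕ
        supply (a′ , b′) = (y a′ b′ when Arcᴰ? a′ b′) when (ψ (a′ , b′) ≟ᴰ² (a , b))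

        scaling : Additive {⊤} (λ g → υ * g tt)
        scaling = record { F-cong = λ eq → ≡.cong (υ *_) (eq tt)
                         ; F-homo = λ g h → ℕ.*-distribˡ-+ υ (g tt) (h tt) ; F-zero = ℕ.*-zeroʳ υ }

        installed : ∀ a′ b′ (d : Dec (TimedNetwork.Arcᴰ G_T a′ b′)) (d′ : Dec (ψ (a′ , b′) ≡ (a , b))) →
                    ((Full.load X a′ b′ when d) when d′) ≤ υ * ((y a′ b′ when d) when d′)
        -- `ψ` keeps the underlying arc, so both capacities have the same coefficient `u`.
        installed a′ b′ (yes a∈) (yes refl) = F.capacity a′ b′ a∈
        installed a′ b′ (no _)   (yes _)    = z≤n
        installed a′ b′ _        (no _)     = z≤n

        bounded : ∀ α → ∑ᴷ (share α) ≤ υ * supply α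
        bounded α@(a′ , b′) = ≡.subst (_≤ υ * supply α)
          (≡.sym (≡.trans
            (IsSummation.∑-when ∑ᴷ-sum (ψ α ≟ᴰ² (a , b))
              (λ (k , p , p′) → (q k * move k p p′ when ℰᵀ? a′ b′ p p′) when Arcᴰ? a′ b′))
            (≡.cong (_when (ψ α ≟ᴰ² (a , b))) (IsSummation.∑-when ∑ᴷ-sum (Arcᴰ? a′ b′)
              (λ (k , p , p′) → q k * move k p p′ when ℰᵀ? a′ b′ p p′)))))
          (installed a′ b′ (Arcᴰ? a′ b′) (ψ α ≟ᴰ² (a , b)))

      capacity-Y : Partial.load Y a b ≤ u (proj₁ a) (proj₁ b) * y′ a b
      capacity-Y = ℕ.≤-trans load≤φ-load (ℕ.≤-trans φ-load≤shares shares≤y′)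

    Y-feasible : Partial.Feasible Y × (∀ k → ℤ.+ Partial.duration Y k ℤ.≤ l k ⊖ r k)
    Y-feasible = record
      { balance-origin      = λ k p _ → supply-Y k p
      ; balance-destination = λ k p _ → demand-Y k p
      ; balance-otherwise   = λ k p _ → conservation-Y k p
      ; capacity            = capacity-Y
      ; move-binary         = λ k → W.moves-binary k (route k) (proj₁ (proj₂ (simple-route k)))
      ; hold-binary         = λ k → W.holds-binary k (route k) (proj₁ (proj₂ (simple-route k)))
      ; move-support        = moves-supportᵏ
      ; hold-support        = holds-supportᵏ
      } , λ k → ≤-⊖ (duration-Y k)

    -- Cost comparison

    open OrderedAbelianGroup R using (Carrier; _≈_; _∙_; _·_; _≼_; isTotalOrder; ∙-monoˡ; comm; commutativeMonoid; monoid)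
      renaming (ε to 0#; refl to ≈-refl; sym to ≈-sym; trans to ≈-trans; identityˡ to ∙-identityˡ)
    open IsTotalOrder isTotalOrder using (reflexive) renaming (isPreorder to ≼-isPreorder; trans to ≼-trans)
    open Mult monoid using (×-homo-+)

    ∙-mono : ∀ {x y u v} → x ≼ y → u ≼ v → (x ∙ u) ≼ (y ∙ v)
    ∙-mono {x} {y} {u} {v} x≼y u≼v = ≼-trans (∙-monoˡ u x≼y)
      (≼-trans (reflexive (comm y u)) (≼-trans (∙-monoˡ y u≼v) (reflexive (comm v y))))

    costs : PreorderedMonoid _ _ _
    costs = record { commutativeMonoid = commutativeMonoid ; isPreorder = ≼-isPreorder ; ∙-mono = ∙-mono }

    private
      module S = NetworkSums costs

    ·-nonneg : ∀ m {x} → 0# ≼ x → 0# ≼ (m · x)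
    ·-nonneg ℕ.zero    _   = reflexive ≈-refl
    ·-nonneg (ℕ.suc m) 0≼x = ≼-trans (reflexive (≈-sym (∙-identityˡ 0#))) (∙-mono 0≼x (·-nonneg m 0≼x))

    sum-· : ∀ m (g : Fin m → ℕ) x → (sum g · x) ≈ S.sum (λ i → g i · x)
    sum-· ℕ.zero    g x = ≈-refl
    sum-· (ℕ.suc m) g x = ≈-trans (×-homo-+ x (g Fin.zero) (sum (g ∘ Fin.suc)))
      (OrderedAbelianGroup.∙-congˡ R (sum-· m (g ∘ Fin.suc) x))

    ∑ᴺ-· : ∀ (g : DNode → ℕ) x → (∑ᴺ g · x) ≈ S.∑ᴺ (λ a → g a · x)
    ∑ᴺ-· g x = ≈-trans (sum-· n (λ v → ∑ᵗ λ t → g (v , t)) x)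
      (S.IsSummation.∑-cong (S.fin-sum n) λ v _ → sum-· (ℕ.suc T) (λ t → g (v , toℕ t)) x)

    ∑ᴺ²-· : ∀ (g : DNode × DNode → ℕ) x →
            ((∑ᴺ λ a → ∑ᴺ λ b → g (a , b)) · x) ≈ (S.∑ᴺ λ a → S.∑ᴺ λ b → g (a , b) · x)
    ∑ᴺ²-· g x = ≈-trans (∑ᴺ-· (λ a → ∑ᴺ λ b → g (a , b)) x)
      (S.IsSummation.∑-cong S.∑ᴺ-sum λ a _ → ∑ᴺ-· (λ b → g (a , b)) x)

    fixed : DNode × DNode → Carrier
    fixed (a , b) = y a b · f (proj₁ a) (proj₁ b) S.when Arcᴰ? a b

    fixed-nonneg : ∀ α → 0# ≼ fixed α
    fixed-nonneg (a , b) = S.when-nonneg (Arcᴰ? a b) λ (w∈ , _) →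
      ·-nonneg (y a b) (proj₁ (f-pos w∈))

    ψ-range : ∀ α → (⊤ × proj₂ (proj₁ α) ≤ T) × (⊤ × proj₂ (proj₂ α) ≤ T) →
              (⊤ × proj₂ (proj₁ (ψ α)) ≤ T) × (⊤ × proj₂ (proj₂ (ψ α)) ≤ T) ⊎ fixed α ≈ 0#
    ψ-range ((v , t) , (w , t′)) _ = case (Arcᴰ? (v , t) (w , t′))
      where
      σ = ρ (copy v w) t
      case : (a∈? : Dec (TimedNetwork.Arcᴰ G_T (v , t) (w , t′))) →
             (⊤ × σ ≤ T) × (⊤ × ρᴺ w (σ + τ v w) ≤ T) ⊎
             (y (v , t) (w , t′) · f v w S.when a∈?) ≈ 0#
      case (no _) = inj₂ ≈-refl
      case (yes (_ , refl , t′≤T)) = inj₁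
        ( (tt , ℕ.≤-trans (ρ≤ (copy v w) t) (ℕ.m+n≤o⇒m≤o t t′≤T))
        , (tt , ℕ.≤-trans (proj₁ (ρᴺ-latest w (σ + τ v w)))
                  (ℕ.≤-trans (ℕ.+-monoˡ-≤ (τ v w) (ρ≤ (copy v w) t)) t′≤T)))

    fixed-Y : (S.∑ᴺ λ a → S.∑ᴺ λ b → y′ a b · f (proj₁ a) (proj₁ b) S.when TimedNetwork.Arcᴰ? timed a b) ≼
              (S.∑ᴺ λ a → S.∑ᴺ λ b → fixed (a , b))
    fixed-Y = ≼-trans
      (S.IsSummation.∑-mono S.∑ᴺ²-sum
        {λ (a , b) → y′ a b · f (proj₁ a) (proj₁ b) S.when TimedNetwork.Arcᴰ? timed a b}
        {λ α′ → S.∑ᴺ λ a → S.∑ᴺ λ b → fixed (a , b) S.when (ψ (a , b) ≟ᴰ² α′)}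
        λ (a , b) _ → ≼-trans
          (S.when-≤ (TimedNetwork.Arcᴰ? timed a b) (·-nonneg′ a b))
          (reflexive (collect a b)))
      (reflexive (S.∑-fibres S.∑ᴺ²-sum S.∑ᴺ²-sum _≟ᴰ²_ _≟ᴰ²_ ψ {fixed} ψ-range))
      where
      split : ∀ α α′ (d : Dec (TimedNetwork.Arcᴰ G_T (proj₁ α) (proj₂ α))) (d′ : Dec (ψ α ≡ α′)) →
              (((y (proj₁ α) (proj₂ α) when d) when d′) · f (proj₁ (proj₁ α′)) (proj₁ (proj₂ α′))) ≈
              ((y (proj₁ α) (proj₂ α) · f (proj₁ (proj₁ α)) (proj₁ (proj₂ α)) S.when d) S.when d′)
      split α α′ (yes _) (yes refl) = ≈-refl
      split α α′ (no _)  (yes refl) = ≈-refl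
      split α α′ _       (no _)     = ≈-refl

      collect : ∀ a b → (y′ a b · f (proj₁ a) (proj₁ b)) ≈
                        (S.∑ᴺ λ a′ → S.∑ᴺ λ b′ → fixed (a′ , b′) S.when (ψ (a′ , b′) ≟ᴰ² (a , b)))
      collect a b = ≈-trans
        (∑ᴺ²-· (λ (a′ , b′) → (y a′ b′ when Arcᴰ? a′ b′) when (ψ (a′ , b′) ≟ᴰ² (a , b))) (f (proj₁ a) (proj₁ b)))
        (S.IsSummation.∑-cong S.∑ᴺ²-sum
          {λ (a′ , b′) → ((y a′ b′ when Arcᴰ? a′ b′) when (ψ (a′ , b′) ≟ᴰ² (a , b))) · f (proj₁ a) (proj₁ b)}
          {λ (a′ , b′) → fixed (a′ , b′) S.when (ψ (a′ , b′) ≟ᴰ² (a , b))}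
          λ α _ → split α (a , b) (Arcᴰ? (proj₁ α) (proj₂ α)) (ψ α ≟ᴰ² (a , b)))

      -- The sign of `f` is known on arcs of `D` only, so nonnegativity is read off the fibre sum,
      -- whose nonzero terms belong to arcs.
      ·-nonneg′ : ∀ a b → 0# ≼ (y′ a b · f (proj₁ a) (proj₁ b))
      ·-nonneg′ a b = ≼-trans
        (≼-trans (reflexive (≈-sym (S.IsSummation.∑-zero S.∑ᴺ²-sum)))
          (S.IsSummation.∑-mono S.∑ᴺ²-sum {const 0#}
            {λ α → fixed α S.when (ψ α ≟ᴰ² (a , b))}
            λ α _ → S.when-nonneg (ψ α ≟ᴰ² (a , b)) λ _ → fixed-nonneg α))
        (reflexive (≈-sym (collect a b)))

    flow-cost : Commodity → TNode × TNode → ℕ → Carrier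
    flow-cost k (p , p′) m = (q k * m) · c k (proj₁ (proj₁ p)) (proj₁ (proj₁ p′))

    flow-cost-0 : ∀ k e {Q : Set} (Q? : Dec Q) → (flow-cost k e 0 S.when Q?) ≈ 0#
    flow-cost-0 k e Q? = S.when-false Q? λ _ →
      ≡.subst (λ m → (m · c k (proj₁ (proj₁ (proj₁ e))) (proj₁ (proj₁ (proj₂ e)))) ≈ 0#) (≡.sym (ℕ.*-zeroʳ (q k))) ≈-refl

    -- `φ` keeps the underlying arc and thus the unit cost, so `route-dominated` applies to each
    -- commodity.
    variable-Y : (S.sum λ k → S.∑ⱽ λ p → S.∑ⱽ λ p′ →
                    flow-cost k (p , p′) (Variables.move Y k p p′) S.when E_S? p p′) ≼
                 (S.sum λ k → S.∑ⱽ λ p → S.∑ⱽ λ p′ →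
                    flow-cost k (p , p′) (move k p p′) S.when TimedNetwork.Move? G_T p p′)
    variable-Y = S.IsSummation.∑-mono (S.fin-sum κ)
      {λ k → S.∑ⱽ λ p → S.∑ⱽ λ p′ → flow-cost k (p , p′) (Variables.move Y k p p′) S.when E_S? p p′}
      {λ k → S.∑ⱽ λ p → S.∑ⱽ λ p′ → flow-cost k (p , p′) (move k p p′) S.when TimedNetwork.Move? G_T p p′}
      λ k _ → route-dominated costs k
        (λ e m → flow-cost k e m S.when TimedNetwork.Move? G_T (proj₁ e) (proj₂ e))
        (λ e m → flow-cost k e m S.when E_S? (proj₁ e) (proj₂ e))
        (λ e → flow-cost-0 k e (TimedNetwork.Move? G_T (proj₁ e) (proj₂ e)))
        (λ e → flow-cost-0 k e (E_S? (proj₁ e) (proj₂ e)))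
        (λ e m∈ → ≡.subst (0# ≼_) (≡.sym (S.when-true (TimedNetwork.Move? G_T (proj₁ e) (proj₂ e)) (proj₁ m∈)))
          (nonneg k e m∈))
        (λ e m∈ → ≡.subst ((flow-cost k (φ e) 1 S.when E_S? (proj₁ (φ e)) (proj₂ (φ e))) ≼_)
          (≡.sym (S.when-true (TimedNetwork.Move? G_T (proj₁ e) (proj₂ e)) (proj₁ m∈)))
          (S.when-≤ (E_S? (proj₁ (φ e)) (proj₂ (φ e))) (nonneg k e m∈)))
      where
      nonneg : ∀ k e → Full.Moveᵏ k (proj₁ e) (proj₂ e) → 0# ≼ flow-cost k e 1
      nonneg k ((x , _) , (z , _)) ((xz , _) , _) = ·-nonneg (q k * 1) (proj₁ (c-pos k (E⇒A {x} {z} xz)))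

    objective-Y : Partial.objective Y ≼ Full.objective X
    objective-Y = ∙-mono fixed-Y variable-Y

-- Comparison of the optimal values

theorem3 : ∀ {a ℓ₁ ℓ₂} (R : OrderedAbelianGroup a ℓ₁ ℓ₂)
    (I : Instance R) (P : ValidPartition I)
    (G_S : Auxiliary.PartialNetwork P) →
    Auxiliary.PartialNetwork.P1′ G_S →
    Auxiliary.PartialNetwork.P2′ G_S →
    (z_S z_T : OrderedAbelianGroup.Carrier R ⁺) →
    IsOptimalValue (SND-RR-partial P G_S) z_S →
    IsOptimalValue (SND-RR-full P) z_T →
    OrderedAbelianGroup._≤⁺_ R z_S z_T
theorem3 R I P G_S p1 p2 z_S ⊤⁺ _ _ = z_S ≤⊤⁺
-- A finite optimal value is attained, and the solution induced by an optimal one refutes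
-- infeasibility.
theorem3 R I P G_S p1 p2 ⊤⁺ [ z_T ] (lift infeasible) ((X , X-feasible , _) , _) =
  contradiction (Relaxation.Y-feasible P G_S p1 p2 X X-feasible) (infeasible _)
theorem3 R I P G_S p1 p2 [ z_S ] [ z_T ] (_ , z_S-least) ((X , X-feasible , X≈z_T) , _) =
  [ ≼-trans (z_S-least Y Y-feasible) (≼-trans objective-Y (reflexive X≈z_T)) ]
  where
  open Relaxation P G_S p1 p2 X X-feasible
  open IsTotalOrder (OrderedAbelianGroup.isTotalOrder R) using (reflexive) renaming (trans to ≼-trans)
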